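{- An epr-sequence of order $n$, and starting with $\mathtt{A}$, is attainable by a symmetric matrix over $\mathbb{Z}_2$ if and only if it has one of the following forms: 1. $\mathtt{A}\overline{\mathtt{A}}$; 2. $\mathtt{A}\overline{\mathtt{S}}\mathtt{N}\overline{\mathtt{N}}$; 3. $\mathtt{ASS}\overline{\mathtt{S}}\mathtt{A}$; 4. $\mathtt{ASS}\overline{\mathtt{S}}\mathtt{AA}$; 5. $\mathtt{ASSS}\overline{\mathtt{S}}\mathtt{AN}$ with $n$ even; 6. $\mathtt{ASA}\overline{\mathtt{SA}}$; 7. $\mathtt{ASA}\overline{\mathtt{SA}}\mathtt{A}$; 8. $\mathtt{ASA}\overline{\mathtt{SA}}\mathtt{N}$.
   Context: $\mathbb{Z}_2$ is the field of integers modulo $2$. For an $n\times n$ symmetric matrix $B$ over a field $\mathbb{F}$, the enhanced principal rank characteristic sequence (epr-sequence) is $\operatorname{epr}(B)=\ell_1\ell_2\cdots\ell_n$, where $\ell_k=\mathtt{A}$ if all principal minors of $B$ of order $k$ are nonzero, $\ell_k=\mathtt{S}$ if some but not all principal minors of order $k$ are nonzero, and $\ell_k=\mathtt{N}$ if all principal minors of order $k$ are zero. A finite nonempty sequence over $\{\mathtt{A},\mathtt{S},\mathtt{N}\}$ is attainable over $\mathbb{F}$ if it equals $\operatorname{epr}(B)$ for some symmetric matrix $B$ over $\mathbb{F}$; its order is its length. In a form, an overlined block $\overline{t_1\cdots t_k}$ stands for the block $t_1\cdots t_k$ repeated any number of times $\geq 0$ (so it may be omitted entirely); a sequence "has a form"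 if it is obtained by some choice of the repetition numbers, chosen independently for each overlined block. -}

module Defs where

open import Algebra.Bundles using (CommutativeRing)
open import Data.Fin.Base as Fin using (Fin; zero; suc; toℕ; punchIn)
open import Data.List.Base using (List; concat; replicate)
open import Data.Nat.Base using (ℕ; zero; suc)
open import Data.Parity.Properties using (+-*-commutativeRing)
open import Data.Product.Base using (Σ-syntax; ∃-syntax; _×_; _,_)
open import Data.Vec.Base using (Vec; lookup)
open import Level using (0ℓ; _⊔_)
open import Relation.Binary.Core using (_Preserves_⟶_)
open import Relation.Nullary.Negation.Core using (¬_)

data Letter : Set where
  A S N : Letter

-- A k-element subset {i₁ < … < iₖ} of the index set Fin n, given by its
-- increasing enumeration.
IndexSet : ℕ → ℕ → Set
IndexSet k n = Σ[ α ∈ (Fin k → Fin n) ] α Preserves Fin._<_ ⟶ Fin._<_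

-- The definitions make sense over any commutative ring; the standard
-- library has no bundle of discrete fields.
module Matrices {c ℓ} (R : CommutativeRing c ℓ) where

  open CommutativeRing R hiding (zero)
  open import Algebra.Properties.Semiring.Exp semiring using (_^_)
  open import Algebra.Properties.Semiring.Sum semiring using (sum)

  SquareMatrix : ℕ → Set c
  SquareMatrix n = Fin n → Fin n → Carrier

  Symmetric : ∀ {n} → SquareMatrix n → Set ℓ
  Symmetric B = ∀ i j → B i j ≈ B j i

  -- Laplace expansion along the first row.
  det : ∀ {n} → SquareMatrix n → Carrier
  det {zero}  B = 1#
  det {suc n} B = sum λ j →
    (- 1#) ^ toℕ j * (B zero j * det λ r s → B (suc r) (punchIn j s))

  principalMinor : ∀ {k n} → SquareMatrix n → IndexSet k n → Carrier
  principalMinor B (α , _) = det λ r s → B (α r) (α s)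

  -- "Some but not all are nonzero" is read positively: one principal minor
  -- is nonzero and one is zero.
  HasLetter : ∀ {n} → SquareMatrix n → ℕ → Letter → Set ℓ
  HasLetter {n} B k A = (α : IndexSet k n) → ¬ (principalMinor B α ≈ 0#)
  HasLetter {n} B k S = (Σ[ α ∈ IndexSet k n ] ¬ (principalMinor B α ≈ 0#))
                      × (Σ[ α ∈ IndexSet k n ] principalMinor B α ≈ 0#)
  HasLetter {n} B k N = (α : IndexSet k n) → principalMinor B α ≈ 0#

  -- t = epr(B). The position k : Fin n, counted from 0, carries the letter
  -- for the principal minors of order suc (toℕ k). As 1 ≤ suc (toℕ k) ≤ n,
  -- there is at least one such minor, so the three cases exclude each other.
  IsEpr : ∀ {n} → SquareMatrix n → Vec Letter n → Set ℓ
  IsEpr {n} B t = (k : Fin n) → HasLetter B (suc (toℕ k)) (lookup t k)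

AttainableOver : ∀ {c ℓ} (R : CommutativeRing c ℓ) {n : ℕ} →
                 Vec Letter (suc n) → Set (c ⊔ ℓ)
AttainableOver R {n} t = ∃[ B ] Symmetric {suc n} B × IsEpr B t
  where open Matrices R

-- Parity, with its addition and multiplication, is the field of integers
-- modulo 2.
ℤ₂ : CommutativeRing 0ℓ 0ℓ
ℤ₂ = +-*-commutativeRing

-- The block w repeated m ≥ 0 times.
repeat : ℕ → List Letter → List Letter
repeat m w = concat (replicate m w)

{-# OPTIONS --safe #-}
module Submission where

-- Over ℤ₂ signs disappear, and for a symmetric matrix the Laplace expansion
-- along row i and then along column i loses its off-diagonal terms in pairs:
--   det B[F] = bᵢᵢ det B[F∖i] + Σ_{j ≠ i} bᵢⱼ det B[F∖{i,j}].
-- So with a unit diagonal det B[F] counts the matchings of the graph induced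
-- on F, and a second cancellation gives
--   bᵢᵢ det B[F] = Σ_{j ∈ F} bᵢⱼ det B[F∖j].
-- The latter makes N persist. If all minors of order k are nonzero, the two
-- identities on a set F of k + 2 indices give bᵢⱼ = dᵢ + dⱼ + c for i ≠ j in F.
-- For 3 ≤ k ≤ n − 2 this forces t₃ = A, and t₃ = A says that the graph is
-- complete bipartite, bᵢⱼ = dᵢ + dⱼ, whose minors are explicit. In the
-- remaining case ASS the letter A can only come at the last two orders, and
-- AN there means that all degrees are odd, so n is even by the handshake lemma.
-- Conversely, the forms are realised by identity and complete bipartite
-- graphs, by a clique, a path on 3 vertices or a 4-cycle with isolated
-- vertices added, and, for ASSS⋯SAN, by a star K₁,₃ with an even number of
-- leaves attached to one of its leaves.

open import Defs
open import Algebra.Solver.Ring.AlmostCommutativeRing using (fromCommutativeRing)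
import Algebra.Solver.Ring.Simple as RingSolver
open import Data.Fin.Base as Fin using (Fin; zero; suc; toℕ; punchIn)
open import Data.Fin.Properties using () renaming (_≟_ to _≟ᶠ_)
open import Data.List.Base using (List; []; _∷_; _++_; [_]; length)
open import Data.List.Properties using (++-assoc; ++-identityʳ; length-++)
open import Data.Nat.Base as ℕ
  using (ℕ; zero; suc; parity; _≤_; _<_; z≤n; s≤s; s≤s⁻¹; z<s; s<s; s<s⁻¹)
open import Data.Nat.Divisibility using (_∣_; divides)
import Data.Nat.Properties as ℕ
open import Data.Nat.Properties
  using (≤-refl; ≤-trans; <-trans; m≤n⇒m<n∨m≡n; n≤1+n; m≤m+n; m≤n+m; 1+n≰n; suc-injective)
open import Data.Parity.Base using (Parity; 0ℙ; 1ℙ; _*_; _⁻¹) renaming (_+_ to infixl 6 _+_)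
open import Data.Parity.Properties
  using (_≟_; +-*-semiring; *-assoc; *-comm; *-idem; *-identityʳ; *-zeroʳ; +-cancelˡ-≡; +-comm;
         +-identityʳ; p+p≡0ℙ; suc-homo-⁻¹; ⁻¹-involutive)
open import Data.Product.Base using (Σ-syntax; ∃-syntax; _×_; _,_; proj₁; proj₂)
open import Data.Sum.Base using (_⊎_; inj₁; inj₂)
open import Data.Unit.Base using (⊤; tt)
open import Data.Vec.Base using (Vec; []; _∷_; head; lookup; replicate; toList; _[_]≔_)
open import Data.Vec.Properties
  using (length-toList; lookup-replicate; lookup∘update; lookup∘update′)
open import Function.Base using (_∘_; id)
open import Function.Bundles using (_⇔_; mk⇔)
open import Relation.Binary.Core using (_Preserves_⟶_)
open import Relation.Binary.PropositionalEquality
  using (_≡_; _≢_; refl; sym; trans; cong; cong₂; subst; subst₂; module ≡-Reasoning)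
open import Relation.Nullary using (¬_; contradiction; yes; no)

open import Algebra.Properties.Semiring.Exp +-*-semiring using (_^_)
open import Algebra.Properties.Semiring.Sum +-*-semiring
  using (sum; sum-cong-≗; sum-replicate-zero; ∑-distrib-+; ∑-comm; *-distribˡ-sum; *-distribʳ-sum)
open Matrices ℤ₂
open ≡-Reasoning

module ℙ-Solver = RingSolver (fromCommutativeRing ℤ₂) _≟_
open ℙ-Solver using (solve; _:=_; _:+_; _:*_; con)

-- Determinants over ℤ₂

minor : ∀ {n} → SquareMatrix (suc n) → Fin (suc n) → Fin (suc n) → SquareMatrix n
minor M i j r s = M (punchIn i r) (punchIn j s)

det-cong : ∀ {n} {M M′ : SquareMatrix n} → (∀ i j → M i j ≡ M′ i j) → det M ≡ det M′
det-cong {zero}  M≗M′ = refl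
det-cong {suc n} M≗M′ = sum-cong-≗ λ j →
  cong₂ (λ m d → 1ℙ ^ toℕ j * (m * d)) (M≗M′ zero j)
        (det-cong {n} λ r s → M≗M′ (suc r) (punchIn j s))

1^n≡1 : ∀ n → 1ℙ ^ n ≡ 1ℙ
1^n≡1 zero    = refl
1^n≡1 (suc n) = 1^n≡1 n

det-row : ∀ {n} (M : SquareMatrix (suc n)) →
          det M ≡ sum λ j → M zero j * det (minor M zero j)
det-row M = sum-cong-≗ λ j → cong (_* (M zero j * det (minor M zero j))) (1^n≡1 (toℕ j))

-- The minors of the row expansion other than the first are expanded, by induction, along their
-- first column. After exchanging the two sums the inner one is the row expansion of a minor that
-- belongs to the first column.
det-col : ∀ {n} (M : SquareMatrix (suc n)) →
          det M ≡ sum λ i → M i zero * det (minor M i zero)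
det-col {zero}  M = det-row M
det-col {suc n} M = trans (det-row M) (cong (M zero zero * det (minor M zero zero) +_) (begin
  (sum λ j → M zero (suc j) * det (minor M zero (suc j)))
    ≡⟨ (sum-cong-≗ λ j → trans (cong (M zero (suc j) *_) (det-col (minor M zero (suc j))))
                         (*-distribˡ-sum (M zero (suc j)) (λ i → M (suc i) zero * d i j))) ⟩
  (sum λ j → sum λ i → M zero (suc j) * (M (suc i) zero * d i j))
    ≡⟨ ∑-comm (λ j i → M zero (suc j) * (M (suc i) zero * d i j)) ⟩
  (sum λ i → sum λ j → M zero (suc j) * (M (suc i) zero * d i j))
    ≡⟨ (sum-cong-≗ λ i → trans
         (sum-cong-≗ λ j → solve 3 (λ x y z → x :* (y :* z) := y :* (x :* z)) refl
                             (M zero (suc j)) (M (suc i) zero) (d i j))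
         (trans (sym (*-distribˡ-sum (M (suc i) zero) (λ j → M zero (suc j) * d i j)))
           (cong (M (suc i) zero *_) (sym (det-row (minor M (suc i) zero)))))) ⟩
  (sum λ i → M (suc i) zero * det (minor M (suc i) zero)) ∎))
  where
  d : Fin (suc n) → Fin (suc n) → Parity
  d i j = det (minor (minor M zero zero) i j)

det-transpose : ∀ {n} (M : SquareMatrix n) → det (λ i j → M j i) ≡ det M
det-transpose {zero}  M = refl
det-transpose {suc n} M = begin
  det (λ i j → M j i)                               ≡⟨ det-row (λ i j → M j i) ⟩
  (sum λ j → M j zero * det (λ r s → minor M j zero s r))
    ≡⟨ (sum-cong-≗ λ j → cong (M j zero *_) (det-transpose (minor M j zero))) ⟩
  (sum λ j → M j zero * det (minor M j zero))       ≡⟨ det-col M ⟨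
  det M                                             ∎

sum-zero : ∀ {n} {f : Fin n → Parity} → (∀ i → f i ≡ 0ℙ) → sum f ≡ 0ℙ
sum-zero {n} f≡0 = trans (sum-cong-≗ f≡0) (sum-replicate-zero n)

-- Off-diagonal terms occur twice and cancel.
sum-symmetric : ∀ {n} (P : Fin n → Fin n → Parity) → (∀ i j → P i j ≡ P j i) →
                (sum λ i → sum λ j → P i j) ≡ sum λ i → P i i
sum-symmetric {zero}  P P-sym = refl
sum-symmetric {suc n} P P-sym = begin
  P zero zero + r + (sum λ i → P (suc i) zero + sum λ j → P (suc i) (suc j))
    ≡⟨ cong (P zero zero + r +_) (trans (∑-distrib-+ (λ i → P (suc i) zero) _)
         (cong₂ _+_ (sum-cong-≗ λ i → P-sym (suc i) zero)
                    (sum-symmetric (λ i j → P (suc i) (suc j)) λ i j → P-sym (suc i) (suc j)))) ⟩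
  P zero zero + r + (r + t)
    ≡⟨ solve 3 (λ a r t → a :+ r :+ (r :+ t) := a :+ t) refl (P zero zero) r t ⟩
  P zero zero + t ∎
  where
  r t : Parity
  r = sum λ j → P zero (suc j)
  t = sum λ i → P (suc i) (suc i)

-- In the expansion along the first row and the first column, the terms
-- M₀ⱼ Mᵢ₀ and M₀ᵢ Mⱼ₀ cancel.
det-symmetric : ∀ {n} (M : SquareMatrix (suc (suc n))) → Symmetric M →
                det M ≡ M zero zero * det (minor M zero zero)
                      + sum λ j → M zero (suc j) * det (minor (minor M zero zero) j j)
det-symmetric {n} M M-sym = trans (det-row M) (cong (M zero zero * det (minor M zero zero) +_) (begin
  (sum λ j → M zero (suc j) * det (minor M zero (suc j)))
    ≡⟨ (sum-cong-≗ λ j → trans (cong (M zero (suc j) *_) (det-col (minor M zero (suc j))))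
                         (*-distribˡ-sum (M zero (suc j)) (λ i → M (suc i) zero * d i j))) ⟩
  (sum λ j → sum λ i → M zero (suc j) * (M (suc i) zero * d i j))
    ≡⟨ sum-symmetric (λ j i → M zero (suc j) * (M (suc i) zero * d i j)) (λ j i → begin
         M zero (suc j) * (M (suc i) zero * d i j)
           ≡⟨ cong₂ (λ x y → x * (y * d i j)) (M-sym _ _) (M-sym _ _) ⟩
         M (suc j) zero * (M zero (suc i) * d i j)
           ≡⟨ cong (λ x → M (suc j) zero * (M zero (suc i) * x)) (d-sym i j) ⟩
         M (suc j) zero * (M zero (suc i) * d j i)
           ≡⟨ solve 3 (λ x y z → x :* (y :* z) := y :* (x :* z)) refl
                (M (suc j) zero) (M zero (suc i)) (d j i) ⟩
         M zero (suc i) * (M (suc j) zero * d j i) ∎) ⟩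
  (sum λ j → M zero (suc j) * (M (suc j) zero * d j j))
    ≡⟨ (sum-cong-≗ λ j → trans (cong (λ x → M zero (suc j) * (x * d j j)) (M-sym (suc j) zero))
         (trans (sym (*-assoc (M zero (suc j)) _ _)) (cong (_* d j j) (*-idem (M zero (suc j)))))) ⟩
  (sum λ j → M zero (suc j) * d j j) ∎))
  where
  d : Fin (suc n) → Fin (suc n) → Parity
  d i j = det (minor (minor M zero zero) i j)
  d-sym : ∀ i j → d i j ≡ d j i
  d-sym i j = trans (sym (det-transpose (minor (minor M zero zero) i j)))
                    (det-cong {n} λ r s → M-sym (suc (punchIn i s)) (suc (punchIn j r)))

-- Deletion of indices and principal minors on 0-1 vectors

infixl 8 _∖_

_∖_ : ∀ {n} → Vec Parity n → Fin n → Vec Parity n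
χ ∖ i = χ [ i ]≔ 0ℙ

∖-comm : ∀ {n} (χ : Vec Parity n) i j → χ ∖ i ∖ j ≡ χ ∖ j ∖ i
∖-comm (x ∷ χ) zero    zero    = refl
∖-comm (x ∷ χ) zero    (suc j) = refl
∖-comm (x ∷ χ) (suc i) zero    = refl
∖-comm (x ∷ χ) (suc i) (suc j) = cong (x ∷_) (∖-comm χ i j)

-- Both products are 1 exactly when i and j are distinct elements of χ.
∖-weight-comm : ∀ {n} (χ : Vec Parity n) i j →
                lookup χ i * lookup (χ ∖ i) j ≡ lookup χ j * lookup (χ ∖ j) i
∖-weight-comm (x ∷ χ) zero    zero    = refl
∖-weight-comm (x ∷ χ) zero    (suc j) = *-comm x (lookup χ j)
∖-weight-comm (x ∷ χ) (suc i) zero    = *-comm (lookup χ i) x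
∖-weight-comm (x ∷ χ) (suc i) (suc j) = ∖-weight-comm χ i j

corner : ∀ {n} → SquareMatrix (suc n) → SquareMatrix n
corner B i j = B (suc i) (suc j)

-- The principal minor of B on the rows and columns i with χᵢ = 1. For a
-- 0-1 matrix with unit diagonal it counts, modulo 2, the matchings of the
-- graph induced on χ.
pm : ∀ {n} → SquareMatrix n → Vec Parity n → Parity
pm {zero}  B []       = 1ℙ
pm {suc n} B (0ℙ ∷ χ) = pm (corner B) χ
pm {suc n} B (1ℙ ∷ χ) = B zero zero * pm (corner B) χ
                      + sum λ j → B zero (suc j) * (lookup χ j * pm (corner B) (χ ∖ j))

-- The off-diagonal part of an expansion. If v is the row of a vertex outside χ in a graph with unit
-- diagonal, it counts modulo 2 the matchings in which that vertex is matched into χ.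
contract : ∀ {n} → SquareMatrix n → (Fin n → Parity) → Vec Parity n → Parity
contract B v χ = sum λ j → v j * (lookup χ j * pm B (χ ∖ j))

-- A sum over ordered pairs of distinct elements i, j of χ, with weight `v i * w j` and the minor
-- left after deleting both.
contract₂ : ∀ {n} → SquareMatrix n → (v w : Fin n → Parity) → Vec Parity n → Parity
contract₂ B v w χ = sum λ j → v j * (lookup χ j * contract B w (χ ∖ j))

module _ {n} (B : SquareMatrix n) where

  private
    term : (v w : Fin n → Parity) → Vec Parity n → Fin n → Fin n → Parity
    term v w χ i j = v i * (w j * ((lookup χ i * lookup (χ ∖ i) j) * pm B (χ ∖ i ∖ j)))

    contract₂-term : ∀ v w χ → contract₂ B v w χ ≡ sum λ i → sum (term v w χ i)
    contract₂-term v w χ = sum-cong-≗ λ i → begin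
      v i * (lookup χ i * contract B w (χ ∖ i))
        ≡⟨ *-assoc (v i) _ _ ⟨
      v i * lookup χ i * contract B w (χ ∖ i)
        ≡⟨ *-distribˡ-sum (v i * lookup χ i) (λ j → w j * (lookup (χ ∖ i) j * pm B (χ ∖ i ∖ j))) ⟩
      (sum λ j → v i * lookup χ i * (w j * (lookup (χ ∖ i) j * pm B (χ ∖ i ∖ j))))
        ≡⟨ (sum-cong-≗ λ j → solve 5 (λ a b c d e → a :* b :* (c :* (d :* e)) := a :* (c :* ((b :* d) :* e)))
              refl (v i) (lookup χ i) (w j) (lookup (χ ∖ i) j) (pm B (χ ∖ i ∖ j))) ⟩
      sum (term v w χ i) ∎

    term-comm : ∀ v w χ i j → term v w χ i j ≡ term w v χ j i
    term-comm v w χ i j = trans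
      (cong₂ (λ p q → v i * (w j * (p * q))) (∖-weight-comm χ i j) (cong (pm B) (∖-comm χ i j)))
      (solve 3 (λ a b c → a :* (b :* c) := b :* (a :* c)) refl (v i) (w j) _)

  -- The minor left does not depend on the order of the two deletions, so the sums can be exchanged.
  contract₂-comm : ∀ v w χ → contract₂ B v w χ ≡ contract₂ B w v χ
  contract₂-comm v w χ = begin
    contract₂ B v w χ                   ≡⟨ contract₂-term v w χ ⟩
    (sum λ i → sum λ j → term v w χ i j) ≡⟨ ∑-comm (term v w χ) ⟩
    (sum λ j → sum λ i → term v w χ i j) ≡⟨ (sum-cong-≗ λ j → sum-cong-≗ λ i → term-comm v w χ i j) ⟩
    (sum λ j → sum λ i → term w v χ j i) ≡⟨ contract₂-term w v χ ⟨
    contract₂ B w v χ                   ∎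

  -- For equal rows the summand is symmetric, so only the diagonal survives modulo 2; it vanishes
  -- because an index cannot be deleted twice.
  contract₂-self : ∀ v χ → contract₂ B v v χ ≡ 0ℙ
  contract₂-self v χ = begin
    contract₂ B v v χ                  ≡⟨ contract₂-term v v χ ⟩
    (sum λ i → sum λ j → term v v χ i j) ≡⟨ sum-symmetric (term v v χ) (term-comm v v χ) ⟩
    (sum λ i → term v v χ i i)         ≡⟨ sum-zero (λ i → trans
      (cong (λ p → v i * (v i * (lookup χ i * p * pm B (χ ∖ i ∖ i)))) (lookup∘update i χ 0ℙ))
      (solve 3 (λ a b c → a :* (a :* (b :* con 0ℙ :* c)) := con 0ℙ) refl (v i) (lookup χ i) _)) ⟩
    0ℙ ∎

∖-sum : ∀ {n} (χ : Vec Parity n) i → lookup χ i ≡ 1ℙ → ∀ (v g : Fin n → Parity) →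
        (sum λ j → v j * (lookup χ j * g j)) ≡ v i * g i + sum λ j → v j * (lookup (χ ∖ i) j * g j)
∖-sum (x ∷ χ) zero    refl v g =
  cong (v zero * g zero +_) (sym (cong (_+ sum λ j → v (suc j) * (lookup χ j * g (suc j))) (*-zeroʳ (v zero))))
∖-sum (x ∷ χ) (suc i) χᵢ≡1 v g = trans
  (cong (v zero * (x * g zero) +_) (∖-sum χ i χᵢ≡1 (v ∘ suc) (g ∘ suc)))
  (solve 3 (λ a b c → a :+ (b :+ c) := b :+ (a :+ c)) refl (v zero * (x * g zero))
    (v (suc i) * g (suc i)) (sum λ j → v (suc j) * (lookup (χ ∖ i) j * g (suc j))))

lookup-∖ : ∀ {n} (χ : Vec Parity n) i j → lookup (χ ∖ i) j ≡ 1ℙ → lookup (χ ∖ j) i ≡ lookup χ i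
lookup-∖ (x ∷ χ) zero    (suc j) p = refl
lookup-∖ (x ∷ χ) (suc i) zero    p = refl
lookup-∖ (x ∷ χ) (suc i) (suc j) p = lookup-∖ χ i j p

-- Weights are 0 or 1, so summands have to be compared only where the weight is 1.
if-one : ∀ p {x y} → (p ≡ 1ℙ → x ≡ y) → p * x ≡ p * y
if-one 0ℙ h = refl
if-one 1ℙ h = h refl

contract-∷ : ∀ {n} (B : SquareMatrix (suc n)) v χ →
             contract B v (1ℙ ∷ χ) ≡ v zero * pm (corner B) χ
               + (B zero zero * contract (corner B) (v ∘ suc) χ
                  + contract₂ (corner B) (v ∘ suc) (B zero ∘ suc) χ)
contract-∷ B v χ = cong (v zero * pm (corner B) χ +_) (begin
  (sum λ j → v (suc j) * (lookup χ j * (b * p j + q j)))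
    ≡⟨ (sum-cong-≗ λ j → solve 5 (λ v x b p q → v :* (x :* (b :* p :+ q)) := b :* (v :* (x :* p)) :+ v :* (x :* q))
          refl (v (suc j)) (lookup χ j) b (p j) (q j)) ⟩
  (sum λ j → b * (v (suc j) * (lookup χ j * p j)) + v (suc j) * (lookup χ j * q j))
    ≡⟨ ∑-distrib-+ (λ j → b * (v (suc j) * (lookup χ j * p j))) _ ⟩
  (sum λ j → b * (v (suc j) * (lookup χ j * p j))) + contract₂ (corner B) (v ∘ suc) (B zero ∘ suc) χ
    ≡⟨ cong (_+ contract₂ (corner B) (v ∘ suc) (B zero ∘ suc) χ)
         (*-distribˡ-sum b (λ j → v (suc j) * (lookup χ j * p j))) ⟨
  b * contract (corner B) (v ∘ suc) χ + contract₂ (corner B) (v ∘ suc) (B zero ∘ suc) χ ∎)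
  where
  b = B zero zero
  p q : _ → Parity
  p j = pm (corner B) (χ ∖ j)
  q j = contract (corner B) (B zero ∘ suc) (χ ∖ j)

-- The expansion of a symmetric determinant along row and column i. The recursion of `pm` provides
-- it only for the first index of χ.
ExpandsAlong : ∀ {n} → SquareMatrix n → Fin n → Set
ExpandsAlong B i = ∀ χ → lookup χ i ≡ 1ℙ →
                   pm B χ ≡ B i i * pm B (χ ∖ i) + contract B (B i) (χ ∖ i)

-- The term of i is split off and the other minors, which still contain i, are expanded along it.
-- The expansion is a hypothesis so that the lemma can serve in the induction for `pm-expand`
-- itself.
contract-expand : ∀ {n} (B : SquareMatrix n) i → ExpandsAlong B i →
                  ∀ v χ → lookup χ i ≡ 1ℙ →
                  contract B v χ ≡ v i * pm B (χ ∖ i)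
                    + (B i i * contract B v (χ ∖ i) + contract₂ B v (B i) (χ ∖ i))
contract-expand B i expand v χ χᵢ≡1 = trans
  (∖-sum χ i χᵢ≡1 v (λ j → pm B (χ ∖ j))) (cong (v i * pm B (χ ∖ i) +_) (begin
  (sum λ j → v j * (y j * pm B (χ ∖ j)))
    ≡⟨ (sum-cong-≗ λ j → cong (v j *_) (if-one (y j) λ yⱼ≡1 →
          trans (expand (χ ∖ j) (trans (lookup-∖ χ i j yⱼ≡1) χᵢ≡1))
                (cong (λ ψ → B i i * pm B ψ + contract B (B i) ψ) (∖-comm χ j i)))) ⟩
  (sum λ j → v j * (y j * (B i i * p j + q j)))
    ≡⟨ (sum-cong-≗ λ j → solve 5 (λ v x b p q → v :* (x :* (b :* p :+ q)) := b :* (v :* (x :* p)) :+ v :* (x :* q))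
          refl (v j) (y j) (B i i) (p j) (q j)) ⟩
  (sum λ j → B i i * (v j * (y j * p j)) + v j * (y j * q j))
    ≡⟨ ∑-distrib-+ (λ j → B i i * (v j * (y j * p j))) _ ⟩
  (sum λ j → B i i * (v j * (y j * p j))) + contract₂ B v (B i) (χ ∖ i)
    ≡⟨ cong (_+ contract₂ B v (B i) (χ ∖ i)) (*-distribˡ-sum (B i i) (λ j → v j * (y j * p j))) ⟨
  B i i * contract B v (χ ∖ i) + contract₂ B v (B i) (χ ∖ i) ∎))
  where
  y p q : _ → Parity
  y j = lookup (χ ∖ i) j
  p j = pm B (χ ∖ i ∖ j)
  q j = contract B (B i) (χ ∖ i ∖ j)

-- If the first index is in χ, the minor is expanded along it and then, by induction, along i. The
-- same terms arise in the other order, since the entry joining the two indices is symmetric and so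
-- is the double contraction.
pm-expand : ∀ {n} (B : SquareMatrix n) → Symmetric B → ∀ i → ExpandsAlong B i
pm-expand B B-sym zero    (1ℙ ∷ χ) refl =
  cong (B zero zero * pm (corner B) χ +_)
    (sym (cong (_+ contract (corner B) (B zero ∘ suc) χ) (*-zeroʳ (B zero zero))))
pm-expand B B-sym (suc i) (0ℙ ∷ χ) χᵢ≡1 = trans
  (pm-expand (corner B) (λ r s → B-sym (suc r) (suc s)) i χ χᵢ≡1)
  (cong (B (suc i) (suc i) * pm (corner B) (χ ∖ i) +_)
    (sym (cong (_+ contract (corner B) (B (suc i) ∘ suc) (χ ∖ i)) (*-zeroʳ (B (suc i) zero)))))
pm-expand B B-sym (suc i) (1ℙ ∷ χ) χᵢ≡1 = begin
  b₀ * pm C χ + contract C b χ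
    ≡⟨ cong₂ (λ x y → b₀ * x + y) (expand χ χᵢ≡1) (contract-expand C i expand b χ χᵢ≡1) ⟩
  b₀ * (c * pm C ψ + contract C (C i) ψ)
    + (b i * pm C ψ + (c * contract C b ψ + contract₂ C b (C i) ψ))
    ≡⟨ cong₂ (λ x y → b₀ * (c * pm C ψ + contract C (C i) ψ)
                    + (x * pm C ψ + (c * contract C b ψ + y)))
         (B-sym zero (suc i)) (contract₂-comm C b (C i) ψ) ⟩
  b₀ * (c * pm C ψ + contract C (C i) ψ)
    + (B (suc i) zero * pm C ψ + (c * contract C b ψ + contract₂ C (C i) b ψ))
    ≡⟨ solve 7 (λ b₀ c p q v r s → b₀ :* (c :* p :+ q) :+ (v :* p :+ (c :* r :+ s))
                 := c :* (b₀ :* p :+ r) :+ (v :* p :+ (b₀ :* q :+ s))) refl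
         b₀ c (pm C ψ) (contract C (C i) ψ) (B (suc i) zero) (contract C b ψ) (contract₂ C (C i) b ψ) ⟩
  c * (b₀ * pm C ψ + contract C b ψ)
    + (B (suc i) zero * pm C ψ + (b₀ * contract C (C i) ψ + contract₂ C (C i) b ψ))
    ≡⟨ cong (c * (b₀ * pm C ψ + contract C b ψ) +_) (contract-∷ B (B (suc i)) ψ) ⟨
  c * pm B (1ℙ ∷ ψ) + contract B (B (suc i)) (1ℙ ∷ ψ) ∎
  where
  C = corner B
  b = B zero ∘ suc
  b₀ = B zero zero
  c = C i i
  ψ = χ ∖ i
  expand = pm-expand C (λ r s → B-sym (suc r) (suc s)) i

-- The double sum over pairs of neighbours of i is symmetric and vanishes.
pm-deletions : ∀ {n} (B : SquareMatrix n) → Symmetric B → ∀ i χ → lookup χ i ≡ 1ℙ →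
               contract B (B i) χ ≡ B i i * pm B χ
pm-deletions B B-sym i χ χᵢ≡1 = begin
  contract B (B i) χ
    ≡⟨ contract-expand B i expand (B i) χ χᵢ≡1 ⟩
  B i i * p + (B i i * q + contract₂ B (B i) (B i) (χ ∖ i))
    ≡⟨ cong (λ x → B i i * p + (B i i * q + x)) (contract₂-self B (B i) (χ ∖ i)) ⟩
  B i i * p + (B i i * q + 0ℙ)
    ≡⟨ solve 3 (λ a p q → a :* p :+ (a :* q :+ con 0ℙ) := a :* (p :+ q)) refl (B i i) p q ⟩
  B i i * (p + q)
    ≡⟨ lem (B i i) p q ⟩
  B i i * (B i i * p + q)
    ≡⟨ cong (B i i *_) (expand χ χᵢ≡1) ⟨
  B i i * pm B χ ∎
  where
  expand = pm-expand B B-sym i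
  p = pm B (χ ∖ i)
  q = contract B (B i) (χ ∖ i)
  lem : ∀ a p q → a * (p + q) ≡ a * (a * p + q)
  lem 0ℙ p q = refl
  lem 1ℙ p q = refl

-- Index sets as 0-1 vectors

infix 4 _HasSize_

-- A proof of the size has the shape of the 0-1 vector, so the increasing enumeration of the subset
-- can be read off by recursion on it.
data _HasSize_ : ∀ {n} → Vec Parity n → ℕ → Set where
  []   : [] HasSize 0
  skip : ∀ {n k} {χ : Vec Parity n} → χ HasSize k → 0ℙ ∷ χ HasSize k
  keep : ∀ {n k} {χ : Vec Parity n} → χ HasSize k → 1ℙ ∷ χ HasSize suc k

enum : ∀ {n k} {χ : Vec Parity n} → χ HasSize k → Fin k → Fin n
enum (skip s) i       = suc (enum s i)
enum (keep s) zero    = zero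
enum (keep s) (suc i) = suc (enum s i)

enum-increasing : ∀ {n k} {χ : Vec Parity n} (s : χ HasSize k) →
                  enum s Preserves Fin._<_ ⟶ Fin._<_
enum-increasing (skip s) i<j                               = s<s (enum-increasing s i<j)
enum-increasing (keep s) {zero}  {suc j} i<j = z<s
enum-increasing (keep s) {suc i} {suc j} i<j = s<s (enum-increasing s (s<s⁻¹ i<j))

private
  pred⁺ : ∀ {n} (i : Fin (suc n)) → zero {n} Fin.< i → ∃[ j ] i ≡ suc j
  pred⁺ (suc i) _ = i , refl

  lower : ∀ {k n} (α : Fin k → Fin (suc n)) → α Preserves Fin._<_ ⟶ Fin._<_ →
          (∀ i → zero {n} Fin.< α i) →
          Σ[ β ∈ (Fin k → Fin n) ] (β Preserves Fin._<_ ⟶ Fin._<_) × (∀ i → α i ≡ suc (β i))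
  lower α α-inc α>0 = β , (λ {i} {j} i<j → s<s⁻¹ (subst₂ Fin._<_ (α≡ i) (α≡ j) (α-inc i<j))) , α≡
    where
    β = λ i → proj₁ (pred⁺ (α i) (α>0 i))
    α≡ = λ i → proj₂ (pred⁺ (α i) (α>0 i))

-- By monotonicity the index 0 can only be the value at `zero`, and this decides the first entry of
-- the vector. All remaining values are positive and can be lowered by one.
increasing⇒enum : ∀ {k n} (α : Fin k → Fin n) → α Preserves Fin._<_ ⟶ Fin._<_ →
                  ∃[ χ ] Σ[ s ∈ χ HasSize k ] (∀ i → α i ≡ enum s i)
increasing⇒enum {zero}  {zero}  α α-inc = [] , [] , λ ()
increasing⇒enum {suc k} {zero}  α α-inc with () ← α zero
increasing⇒enum {zero}  {suc n} α α-inc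
  with χ , s , _ ← increasing⇒enum {zero} {n} (λ ()) (λ {}) = 0ℙ ∷ χ , skip s , λ ()
increasing⇒enum {suc k} {suc n} α α-inc with α zero in eq
... | zero
  with β , β-inc , α≡ ← lower (α ∘ suc) (α-inc ∘ s<s) (λ i → subst (Fin._< α (suc i)) eq (α-inc z<s))
  with χ , s , β≡ ← increasing⇒enum β β-inc
  = 1ℙ ∷ χ , keep s , λ { zero → eq ; (suc i) → trans (α≡ i) (cong suc (β≡ i)) }
... | suc _
  with β , β-inc , α≡ ← lower α α-inc (λ { zero → subst (zero {n} Fin.<_) (sym eq) z<s
                                         ; (suc i) → <-trans (subst (zero {n} Fin.<_) (sym eq) z<s) (α-inc z<s) })
  with χ , s , β≡ ← increasing⇒enum β β-inc
  = 0ℙ ∷ χ , skip s , λ i → trans (α≡ i) (cong suc (β≡ i))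

delete : ∀ {n k} {χ : Vec Parity n} (s : χ HasSize suc k) j → χ ∖ enum s j HasSize k
delete         (skip s) j       = skip (delete s j)
delete         (keep s) zero    = skip s
delete {k = suc k} (keep s) (suc j) = keep (delete s j)

-- Matches the minors of the Laplace expansion, which skip a position, with deletions in the 0-1
-- vector.
enum-delete : ∀ {n k} {χ : Vec Parity n} (s : χ HasSize suc k) j i →
              enum (delete s j) i ≡ enum s (punchIn j i)
enum-delete (skip s) j       i       = cong suc (enum-delete s j i)
enum-delete (keep s) zero    i       = refl
enum-delete {k = suc k} (keep s) (suc j) zero    = refl
enum-delete {k = suc k} (keep s) (suc j) (suc i) = cong suc (enum-delete s j i)

sum-enum : ∀ {n k} {χ : Vec Parity n} (s : χ HasSize k) (g : Fin n → Parity) →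
           sum (g ∘ enum s) ≡ sum λ i → lookup χ i * g i
sum-enum []       g = refl
sum-enum (skip s) g = sum-enum s (g ∘ suc)
sum-enum (keep s) g = cong (g zero +_) (sum-enum s (g ∘ suc))

-- By `det-symmetric`, the determinant obeys the recursion that defines `pm`. Order 1 is separate
-- because `det-symmetric` starts at order 2.
det-enum : ∀ {n k} (B : SquareMatrix n) → Symmetric B → {χ : Vec Parity n} (s : χ HasSize k) →
           det (λ i j → B (enum s i) (enum s j)) ≡ pm B χ
det-enum {zero}  B B-sym [] = refl
det-enum {suc n} B B-sym (skip s) = det-enum (corner B) (λ i j → B-sym (suc i) (suc j)) s
det-enum {suc n} {suc zero} B B-sym {1ℙ ∷ χ} (keep s) =
  cong₂ (λ x y → B zero zero * x + y)
    (det-enum (corner B) (λ i j → B-sym (suc i) (suc j)) s)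
    (trans (sum-enum s g)
      (sum-cong-≗ λ j → solve 3 (λ x b p → x :* (b :* p) := b :* (x :* p)) refl
        (lookup χ j) (B zero (suc j)) (pm (corner B) (χ ∖ j))))
  where
  g : Fin n → Parity
  g j = B zero (suc j) * pm (corner B) (χ ∖ j)
det-enum {suc n} {suc (suc k)} B B-sym {1ℙ ∷ χ} (keep s) = trans
  (det-symmetric (λ i j → B (enum (keep s) i) (enum (keep s) j)) (λ i j → B-sym _ _))
  (cong₂ (λ x y → B zero zero * x + y)
    (det-enum (corner B) C-sym s)
    (trans
      (sum-cong-≗ λ j → cong (B zero (suc (enum s j)) *_) (trans
        (det-cong λ r t → sym (cong₂ (corner B) (enum-delete s j r) (enum-delete s j t)))
        (det-enum (corner B) C-sym (delete s j))))
      (trans (sum-enum s g)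
        (sum-cong-≗ λ j → solve 3 (λ x b p → x :* (b :* p) := b :* (x :* p)) refl
          (lookup χ j) (B zero (suc j)) (pm (corner B) (χ ∖ j))))))
  where
  C-sym : Symmetric (corner B)
  C-sym i j = B-sym (suc i) (suc j)
  g : Fin n → Parity
  g j = B zero (suc j) * pm (corner B) (χ ∖ j)

-- Letters as conditions on 0-1 vectors

Order : ∀ {n} → SquareMatrix n → ℕ → Letter → Set
Order B k A = ∀ {χ} → χ HasSize k → pm B χ ≡ 1ℙ
Order B k S = (∃[ χ ] χ HasSize k × pm B χ ≡ 1ℙ) × (∃[ χ ] χ HasSize k × pm B χ ≡ 0ℙ)
Order B k N = ∀ {χ} → χ HasSize k → pm B χ ≡ 0ℙ

≢0⇒≡1 : ∀ {p} → ¬ p ≡ 0ℙ → p ≡ 1ℙ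
≢0⇒≡1 {0ℙ} p≢0 = contradiction refl p≢0
≢0⇒≡1 {1ℙ} p≢0 = refl

≡1⇒≢0 : ∀ {p} → p ≡ 1ℙ → ¬ p ≡ 0ℙ
≡1⇒≢0 refl ()

module _ {n} {B : SquareMatrix n} (B-sym : Symmetric B) where

  private
    subset : ∀ {k} → IndexSet k n → Vec Parity n
    subset (α , α-inc) = proj₁ (increasing⇒enum α α-inc)

    subset-size : ∀ {k} (α : IndexSet k n) → subset α HasSize k
    subset-size (α , α-inc) = proj₁ (proj₂ (increasing⇒enum α α-inc))

    pm-subset : ∀ {k} (α : IndexSet k n) → principalMinor B α ≡ pm B (subset α)
    pm-subset (α , α-inc) = trans (det-cong λ i j → cong₂ B (α≡ i) (α≡ j)) (det-enum B B-sym s)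
      where
      s = proj₁ (proj₂ (increasing⇒enum α α-inc))
      α≡ = proj₂ (proj₂ (increasing⇒enum α α-inc))

    indexSet : ∀ {χ k} → χ HasSize k → IndexSet k n
    indexSet s = enum s , enum-increasing s

  HasLetter⇒Order : ∀ {k} l → HasLetter B k l → Order B k l
  HasLetter⇒Order A h s = trans (sym (det-enum B B-sym s)) (≢0⇒≡1 (h (indexSet s)))
  HasLetter⇒Order S ((α , α≢0) , (β , β≡0)) =
    (subset α , subset-size α , trans (sym (pm-subset α)) (≢0⇒≡1 α≢0)) ,
    (subset β , subset-size β , trans (sym (pm-subset β)) β≡0)
  HasLetter⇒Order N h s = trans (sym (det-enum B B-sym s)) (h (indexSet s))

  Order⇒HasLetter : ∀ {k} l → Order B k l → HasLetter B k l
  Order⇒HasLetter A h α = ≡1⇒≢0 (trans (pm-subset α) (h (subset-size α)))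
  Order⇒HasLetter S ((χ , s , χ≡1) , (ψ , t , ψ≡0)) =
    (indexSet s , ≡1⇒≢0 (trans (det-enum B B-sym s) χ≡1)) ,
    (indexSet t , trans (det-enum B B-sym t) ψ≡0)
  Order⇒HasLetter N h α = trans (pm-subset α) (h (subset-size α))

-- Elements, sizes and sums over subsets

infix 4 _∈_ _⊆_
infix 8 _·_

_∈_ : ∀ {n} → Fin n → Vec Parity n → Set
i ∈ χ = lookup χ i ≡ 1ℙ

_⊆_ : ∀ {n} → Vec Parity n → Vec Parity n → Set
χ ⊆ ψ = ∀ {i} → i ∈ χ → i ∈ ψ

-- For a row `B x` with x in χ this is the degree of x inside χ modulo 2, the diagonal entry
-- included.
_·_ : ∀ {n} → (Fin n → Parity) → Vec Parity n → Parity
v · χ = sum λ j → v j * lookup χ j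

1≢0 : ¬ 1ℙ ≡ 0ℙ
1≢0 ()

0≢1 : ¬ 0ℙ ≡ 1ℙ
0≢1 ()

∈-∖⁻ : ∀ {n} (χ : Vec Parity n) {i j} → i ∈ χ ∖ j → i ≢ j × i ∈ χ
∈-∖⁻ χ {i} {j} i∈ with i ≟ᶠ j
... | yes refl = contradiction (trans (sym (lookup∘update i χ 0ℙ)) i∈) 0≢1
... | no i≢j   = i≢j , trans (sym (lookup∘update′ i≢j χ 0ℙ)) i∈

∈-∖⁺ : ∀ {n} (χ : Vec Parity n) {i j} → i ≢ j → i ∈ χ → i ∈ χ ∖ j
∈-∖⁺ χ i≢j i∈ = trans (lookup∘update′ i≢j χ 0ℙ) i∈

size-0 : ∀ {n} {χ : Vec Parity n} → χ HasSize 0 → ∀ i → lookup χ i ≡ 0ℙ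
size-0 (skip s) zero    = refl
size-0 (skip s) (suc i) = size-0 s i

∖-size : ∀ {n k} {χ : Vec Parity n} → χ HasSize suc k → ∀ {i} → i ∈ χ → χ ∖ i HasSize k
∖-size (skip s) {suc i} i∈ = skip (∖-size s i∈)
∖-size (keep s) {zero}  i∈ = skip s
∖-size {k = zero}  (keep s) {suc i} i∈ = contradiction (trans (sym (size-0 s i)) i∈) 0≢1
∖-size {k = suc k} (keep s) {suc i} i∈ = keep (∖-size s i∈)

element : ∀ {n k} {χ : Vec Parity n} → χ HasSize suc k → ∃[ i ] i ∈ χ
element (skip s) with i , i∈ ← element s = suc i , i∈
element (keep s) = zero , refl

∅ : ∀ {n} → Vec Parity n
∅ = replicate _ 0ℙ

∅-size : ∀ {n} → ∅ {n} HasSize 0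
∅-size {zero}  = []
∅-size {suc n} = skip ∅-size

full : ∀ {n} → Vec Parity n
full = replicate _ 1ℙ

full-size : ∀ {n} → full {n} HasSize n
full-size {zero}  = []
full-size {suc n} = keep full-size

size-≤ : ∀ {n k} {χ : Vec Parity n} → χ HasSize k → k ≤ n
size-≤ []       = z≤n
size-≤ (skip s) = ≤-trans (size-≤ s) (n≤1+n _)
size-≤ (keep s) = s≤s (size-≤ s)

size-full : ∀ {n} {χ : Vec Parity n} → χ HasSize n → χ ≡ full
size-full []       = refl
size-full (skip s) = contradiction (size-≤ s) 1+n≰n
size-full (keep s) = cong (1ℙ ∷_) (size-full s)

1+parity : ∀ k → 1ℙ + parity k ≡ parity (suc k)
1+parity k = trans (cong _⁻¹ (sym (suc-homo-⁻¹ k))) (⁻¹-involutive (parity (suc k)))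

size-parity : ∀ {n k} {χ : Vec Parity n} → χ HasSize k → sum (lookup χ) ≡ parity k
size-parity []               = refl
size-parity (skip s)         = size-parity s
size-parity (keep {k = k} s) = trans (cong _⁻¹ (size-parity s)) (1+parity k)

-- Missing indices are added from the front until the size k is reached.
extend : ∀ {n j k} {τ : Vec Parity n} → τ HasSize j → j ≤ k → k ≤ n →
         ∃[ χ ] τ ⊆ χ × χ HasSize k
extend []       j≤k z≤n = [] , id , []
extend {τ = 0ℙ ∷ τ} (skip s) j≤k k≤n with m≤n⇒m<n∨m≡n j≤k | k≤n
... | inj₂ refl      | _ = 0ℙ ∷ τ , id , skip s
... | inj₁ (s≤s j≤k) | s≤s k≤n with χ , τ⊆χ , t ← extend s j≤k k≤n =
  1ℙ ∷ χ , (λ { {zero} _ → refl ; {suc i} i∈ → τ⊆χ i∈ }) , keep t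
extend (keep s) (s≤s j≤k) (s≤s k≤n) with χ , τ⊆χ , t ← extend s j≤k k≤n =
  1ℙ ∷ χ , (λ { {zero} _ → refl ; {suc i} i∈ → τ⊆χ i∈ }) , keep t

sized : ∀ {n k} → k ≤ n → Σ[ χ ∈ Vec Parity n ] χ HasSize k
sized k≤n = let χ , _ , s = extend ∅-size z≤n k≤n in χ , s

insert-size : ∀ {n k} {χ : Vec Parity n} → χ HasSize k → ∀ {i} → lookup χ i ≡ 0ℙ →
              χ [ i ]≔ 1ℙ HasSize suc k
insert-size (skip s) {zero}  i∉ = keep s
insert-size (skip s) {suc i} i∉ = skip (insert-size s i∉)
insert-size (keep s) {suc i} i∉ = keep (insert-size s i∉)

·-∖ : ∀ {n} (χ : Vec Parity n) {i} → i ∈ χ → ∀ v → v · χ ≡ v i + v · (χ ∖ i)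
·-∖ χ {i} i∈ v = begin
  v · χ
    ≡⟨ (sum-cong-≗ λ j → cong (v j *_) (*-identityʳ (lookup χ j))) ⟨
  (sum λ j → v j * (lookup χ j * 1ℙ))
    ≡⟨ ∖-sum χ i i∈ v (λ _ → 1ℙ) ⟩
  v i * 1ℙ + (sum λ j → v j * (lookup (χ ∖ i) j * 1ℙ))
    ≡⟨ cong₂ _+_ (*-identityʳ (v i)) (sum-cong-≗ λ j → cong (v j *_) (*-identityʳ (lookup (χ ∖ i) j))) ⟩
  v i + v · (χ ∖ i) ∎

·-size-0 : ∀ {n} {χ : Vec Parity n} → χ HasSize 0 → ∀ v → v · χ ≡ 0ℙ
·-size-0 s v = sum-zero λ i → trans (cong (v i *_) (size-0 s i)) (*-zeroʳ (v i))

sum≡1 : ∀ {n} (f : Fin n → Parity) → sum f ≡ 1ℙ → ∃[ i ] f i ≡ 1ℙ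
sum≡1 {suc n} f Σ≡1 with f zero in eq
... | 1ℙ = zero , eq
... | 0ℙ with i , fi≡1 ← sum≡1 (f ∘ suc) Σ≡1 = suc i , fi≡1

*-≡1 : ∀ p {q} → p * q ≡ 1ℙ → p ≡ 1ℙ × q ≡ 1ℙ
*-≡1 1ℙ q≡1 = refl , q≡1

-- The set χ = {i, j}, given by the facts that are used about it; `dot` makes sums over χ explicit.
-- It covers both subsets that are met and subsets that are built from two indices.
record Pair {n} (χ : Vec Parity n) (i j : Fin n) : Set where
  field
    size : χ HasSize 2
    i∈   : i ∈ χ
    j∈   : j ∈ χ
    i≢j  : i ≢ j
    dot  : ∀ v → v · χ ≡ v i + v j

record Triple {n} (χ : Vec Parity n) (i j l : Fin n) : Set where
  field
    size : χ HasSize 3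
    i∈   : i ∈ χ
    j∈   : j ∈ χ
    l∈   : l ∈ χ
    i≢j  : i ≢ j
    i≢l  : i ≢ l
    j≢l  : j ≢ l
    dot  : ∀ v → v · χ ≡ v i + (v j + v l)

asPair : ∀ {n} {χ : Vec Parity n} → χ HasSize 2 → ∃[ i ] ∃[ j ] Pair χ i j
asPair {χ = χ} s
  with i , i∈ ← element s
  with j , j∈′ ← element (∖-size s i∈)
  with j≢i , j∈ ← ∈-∖⁻ χ j∈′
  = i , j , record
  { size = s ; i∈ = i∈ ; j∈ = j∈ ; i≢j = j≢i ∘ sym
  ; dot = λ v → trans (·-∖ χ i∈ v) (cong (v i +_) (trans (·-∖ (χ ∖ i) j∈′ v)
            (trans (cong (v j +_) (·-size-0 (∖-size (∖-size s i∈) j∈′) v)) (+-identityʳ (v j))))) }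

asTriple : ∀ {n} {χ : Vec Parity n} → χ HasSize 3 → ∃[ i ] ∃[ j ] ∃[ l ] Triple χ i j l
asTriple {χ = χ} s
  with i , i∈ ← element s
  with j , l , p ← asPair (∖-size s i∈)
  = i , j , l , record
  { size = s ; i∈ = i∈
  ; j∈ = proj₂ (∈-∖⁻ χ (Pair.i∈ p)) ; l∈ = proj₂ (∈-∖⁻ χ (Pair.j∈ p))
  ; i≢j = proj₁ (∈-∖⁻ χ (Pair.i∈ p)) ∘ sym ; i≢l = proj₁ (∈-∖⁻ χ (Pair.j∈ p)) ∘ sym
  ; j≢l = Pair.i≢j p
  ; dot = λ v → trans (·-∖ χ i∈ v) (cong (v i +_) (Pair.dot p v)) }

∖-insert : ∀ {n} (χ : Vec Parity n) i → lookup χ i ≡ 0ℙ → (χ [ i ]≔ 1ℙ) ∖ i ≡ χ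
∖-insert (0ℙ ∷ χ) zero    i∉ = refl
∖-insert (x  ∷ χ) (suc i) i∉ = cong (x ∷_) (∖-insert χ i i∉)

insert-dot : ∀ {n} {χ : Vec Parity n} {i} → lookup χ i ≡ 0ℙ →
             ∀ v → v · (χ [ i ]≔ 1ℙ) ≡ v i + v · χ
insert-dot {χ = χ} {i} i∉ v = trans (·-∖ (χ [ i ]≔ 1ℙ) (lookup∘update i χ 1ℙ) v)
  (cong (λ ψ → v i + v · ψ) (∖-insert χ i i∉))

insert-∈ : ∀ {n} (χ : Vec Parity n) {i j} → i ≢ j → lookup (χ [ j ]≔ 1ℙ) i ≡ lookup χ i
insert-∈ χ i≢j = lookup∘update′ i≢j χ 1ℙ

pair : ∀ {n} → Fin n → Fin n → Vec Parity n
pair i j = ∅ [ j ]≔ 1ℙ [ i ]≔ 1ℙ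

triple : ∀ {n} → Fin n → Fin n → Fin n → Vec Parity n
triple i j l = pair j l [ i ]≔ 1ℙ

pair-isPair : ∀ {n} {i j : Fin n} → i ≢ j → Pair (pair i j) i j
pair-isPair {n} {i} {j} i≢j = record
  { size = insert-size (insert-size ∅-size j∉) i∉
  ; i∈ = lookup∘update i (∅ [ j ]≔ 1ℙ) 1ℙ
  ; j∈ = trans (insert-∈ (∅ [ j ]≔ 1ℙ) (i≢j ∘ sym)) (lookup∘update j ∅ 1ℙ)
  ; i≢j = i≢j
  ; dot = λ v → trans (insert-dot {χ = ∅ [ j ]≔ 1ℙ} i∉ v) (cong (v i +_)
            (trans (insert-dot {χ = ∅} j∉ v)
              (trans (cong (v j +_) (·-size-0 ∅-size v)) (+-identityʳ (v j))))) }
  where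
  j∉ : lookup (∅ {n}) j ≡ 0ℙ
  j∉ = lookup-replicate j 0ℙ
  i∉ : lookup (∅ {n} [ j ]≔ 1ℙ) i ≡ 0ℙ
  i∉ = trans (insert-∈ ∅ i≢j) (lookup-replicate i 0ℙ)

triple-isTriple : ∀ {n} {i j l : Fin n} → i ≢ j → i ≢ l → j ≢ l → Triple (triple i j l) i j l
triple-isTriple {n} {i} {j} {l} i≢j i≢l j≢l = record
  { size = insert-size size i∉
  ; i∈ = lookup∘update i (pair j l) 1ℙ
  ; j∈ = trans (insert-∈ (pair j l) (i≢j ∘ sym)) i∈
  ; l∈ = trans (insert-∈ (pair j l) (i≢l ∘ sym)) j∈
  ; i≢j = i≢j ; i≢l = i≢l ; j≢l = j≢l
  ; dot = λ v → trans (insert-dot {χ = pair j l} i∉ v) (cong (v i +_) (dot v)) }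
  where
  open Pair (pair-isPair j≢l) using (size; i∈; j∈; dot)
  i∉ : lookup (pair j l) i ≡ 0ℙ
  i∉ = trans (insert-∈ (∅ [ l ]≔ 1ℙ) i≢j)
       (trans (insert-∈ ∅ i≢l) (lookup-replicate i 0ℙ))

pm-∅ : ∀ {n} (B : SquareMatrix n) {χ} → χ HasSize 0 → pm B χ ≡ 1ℙ
pm-∅ B []       = refl
pm-∅ B (skip s) = pm-∅ (corner B) s

-- Minors of matrices with unit diagonal

UnitDiagonal : ∀ {n} → SquareMatrix n → Set
UnitDiagonal B = ∀ i → B i i ≡ 1ℙ

module _ {n} {B : SquareMatrix n} (B-sym : Symmetric B) (B-unit : UnitDiagonal B) where

  expand : ∀ χ {i} → i ∈ χ → pm B χ ≡ pm B (χ ∖ i) + contract B (B i) (χ ∖ i)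
  expand χ {i} i∈ = trans (pm-expand B B-sym i χ i∈)
    (cong (λ b → b * pm B (χ ∖ i) + contract B (B i) (χ ∖ i)) (B-unit i))

  deletions : ∀ χ {i} → i ∈ χ → contract B (B i) χ ≡ pm B χ
  deletions χ {i} i∈ = trans (pm-deletions B B-sym i χ i∈) (cong (_* pm B χ) (B-unit i))

  order-1 : Order B 1 A
  order-1 {χ} s with i , i∈ ← element s = begin
    pm B χ
      ≡⟨ expand χ i∈ ⟩
    pm B (χ ∖ i) + contract B (B i) (χ ∖ i)
      ≡⟨ cong₂ _+_ (pm-∅ B (∖-size s i∈)) (sum-zero λ j →
           trans (cong (λ x → B i j * (x * pm B (χ ∖ i ∖ j))) (size-0 (∖-size s i∈) j)) (*-zeroʳ (B i j))) ⟩
    1ℙ ∎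

  -- By `deletions` the minor is a sum of minors of order one lower, so a nonzero minor has a
  -- nonzero summand.
  delete-one : ∀ {χ k} → χ HasSize suc k → pm B χ ≡ 1ℙ → ∃[ i ] i ∈ χ × pm B (χ ∖ i) ≡ 1ℙ
  delete-one {χ} s pm≡1 =
    let i , i∈ = element s
        j , e = sum≡1 (λ j → B i j * (lookup χ j * pm B (χ ∖ j))) (trans (deletions χ i∈) pm≡1)
    in j , *-≡1 (lookup χ j) (proj₂ (*-≡1 (B i j) e))

  shrink : ∀ {χ j k} → χ HasSize k → pm B χ ≡ 1ℙ → j ≤ k →
           ∃[ ψ ] ψ ⊆ χ × ψ HasSize j × pm B ψ ≡ 1ℙ
  shrink {χ} {j} {k} s pm≡1 j≤k with m≤n⇒m<n∨m≡n j≤k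
  ... | inj₂ refl = χ , id , s , pm≡1
  shrink {χ} {j} {suc k} s pm≡1 j≤k | inj₁ (s≤s j≤k′) =
    let i , i∈ , pm′≡1 = delete-one s pm≡1
        ψ , ψ⊆ , t , pmψ≡1 = shrink (∖-size s i∈) pm′≡1 j≤k′
    in ψ , (λ {l} l∈ → proj₂ (∈-∖⁻ χ {l} {i} (ψ⊆ l∈))) , t , pmψ≡1

  -- A nonzero minor of order k would shrink to a nonzero minor of order j.
  N-persists : ∀ {j k} → j ≤ k → Order B j N → Order B k N
  N-persists j≤k all-N {χ} s with pm B χ in eq
  ... | 0ℙ = refl
  ... | 1ℙ with ψ , _ , t , pm≡1 ← shrink s eq j≤k = trans (sym pm≡1) (all-N t)

  contract-constant : ∀ {χ} → (∀ j → j ∈ χ → pm B (χ ∖ j) ≡ 1ℙ) → ∀ v → contract B v χ ≡ v · χ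
  contract-constant {χ} pm≡1 v = sum-cong-≗ λ j → cong (v j *_)
    (trans (if-one (lookup χ j) (pm≡1 j)) (*-identityʳ (lookup χ j)))

  -- Expansion along x leaves the set χ without x, whose one-element deletions have order k and
  -- hence minor 1. So the contraction with the row of x is a plain row sum, and `deletions` at i
  -- writes the minor of that set as another one.
  entry-from-degrees : ∀ {k χ i x} → Order B k A → χ HasSize suc (suc k) → i ∈ χ → x ∈ χ → i ≢ x →
                       pm B χ ≡ 1ℙ + (B i x + (B i · χ + B x · χ))
  entry-from-degrees {k} {χ} {i} {x} all-A s i∈ x∈ i≢x = begin
    pm B χ
      ≡⟨ expand χ x∈ ⟩
    pm B (χ ∖ x) + contract B (B x) (χ ∖ x)
      ≡⟨ cong₂ _+_ (trans (sym (deletions (χ ∖ x) i∈′)) (c≡ (B i))) (c≡ (B x)) ⟩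
    B i · (χ ∖ x) + B x · (χ ∖ x)
      -- The entry b and the constant 1 are each inserted twice; one copy completes a row sum from χ
      -- without x to χ.
      ≡⟨ solve 3 (λ p q b → p :+ q := con 1ℙ :+ (b :+ ((b :+ p) :+ (con 1ℙ :+ q)))) refl
           (B i · (χ ∖ x)) (B x · (χ ∖ x)) (B i x) ⟩
    1ℙ + (B i x + ((B i x + B i · (χ ∖ x)) + (1ℙ + B x · (χ ∖ x))))
      ≡⟨ cong₂ (λ p q → 1ℙ + (B i x + (p + q))) (·-∖ χ x∈ (B i))
           (trans (·-∖ χ x∈ (B x)) (cong (_+ B x · (χ ∖ x)) (B-unit x))) ⟨
    1ℙ + (B i x + (B i · χ + B x · χ)) ∎
    where
    i∈′ : i ∈ χ ∖ x
    i∈′ = ∈-∖⁺ χ i≢x i∈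
    c≡ : ∀ v → contract B v (χ ∖ x) ≡ v · (χ ∖ x)
    c≡ = contract-constant λ j j∈ → all-A (∖-size (∖-size s x∈) j∈)

  -- The case k = 0 of `entry-from-degrees`: the empty minor is 1.
  pm-pair : ∀ {χ i j} → Pair χ i j → pm B χ ≡ 1ℙ + B i j
  pm-pair {χ} {i} {j} p = begin
    pm B χ
      ≡⟨ entry-from-degrees (pm-∅ B) size i∈ j∈ i≢j ⟩
    1ℙ + (B i j + (B i · χ + B j · χ))
      ≡⟨ cong₂ (λ x y → 1ℙ + (B i j + (x + y)))
           (trans (dot (B i)) (cong (_+ B i j) (B-unit i)))
           (trans (dot (B j)) (cong₂ _+_ (B-sym j i) (B-unit j))) ⟩
    1ℙ + (B i j + ((1ℙ + B i j) + (B i j + 1ℙ)))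
      ≡⟨ solve 1 (λ b → con 1ℙ :+ (b :+ ((con 1ℙ :+ b) :+ (b :+ con 1ℙ))) := con 1ℙ :+ b) refl (B i j) ⟩
    1ℙ + B i j ∎
    where open Pair p

  -- The case k = 1 of `entry-from-degrees`: minors of order 1 are diagonal entries.
  pm-triple : ∀ {χ i j l} → Triple χ i j l → pm B χ ≡ 1ℙ + (B i j + (B i l + B j l))
  pm-triple {χ} {i} {j} {l} p = begin
    pm B χ
      ≡⟨ entry-from-degrees order-1 size i∈ j∈ i≢j ⟩
    1ℙ + (B i j + (B i · χ + B j · χ))
      ≡⟨ cong₂ (λ x y → 1ℙ + (B i j + (x + y)))
           (trans (dot (B i)) (cong (_+ (B i j + B i l)) (B-unit i)))
           (trans (dot (B j)) (cong₂ (λ x y → x + (y + B j l)) (B-sym j i) (B-unit j))) ⟩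
    1ℙ + (B i j + ((1ℙ + (B i j + B i l)) + (B i j + (1ℙ + B j l))))
      ≡⟨ solve 3 (λ a b c → con 1ℙ :+ (a :+ ((con 1ℙ :+ (a :+ b)) :+ (a :+ (con 1ℙ :+ c))))
                   := con 1ℙ :+ (a :+ (b :+ c))) refl (B i j) (B i l) (B j l) ⟩
    1ℙ + (B i j + (B i l + B j l)) ∎
    where open Triple p

  -- On ω an entry is the sum of two vertex labels and a constant, so all
  -- triples inside ω have the same number of edges modulo 2.
  pm-triple-within : ∀ {k ω χ} → Order B k A → ω HasSize suc (suc k) → χ ⊆ ω → χ HasSize 3 →
                     pm B χ ≡ pm B ω
  pm-triple-within {k} {ω} {χ} all-A s χ⊆ω t with i , j , l , p ← asTriple t = begin
    pm B χ
      ≡⟨ pm-triple p ⟩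
    1ℙ + (B i j + (B i l + B j l))
      ≡⟨ cong₂ (λ x y → 1ℙ + (x + y)) (entry (χ⊆ω i∈) (χ⊆ω j∈) i≢j)
           (cong₂ _+_ (entry (χ⊆ω i∈) (χ⊆ω l∈) i≢l) (entry (χ⊆ω j∈) (χ⊆ω l∈) j≢l)) ⟩
    1ℙ + ((1ℙ + pm B ω + (d i + d j)) + ((1ℙ + pm B ω + (d i + d l)) + (1ℙ + pm B ω + (d j + d l))))
      ≡⟨ solve 4 (λ e a b c → con 1ℙ :+ ((con 1ℙ :+ e :+ (a :+ b)) :+ ((con 1ℙ :+ e :+ (a :+ c))
                                :+ (con 1ℙ :+ e :+ (b :+ c)))) := e) refl (pm B ω) (d i) (d j) (d l) ⟩
    pm B ω ∎
    where
    open Triple p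
    d : Fin n → Parity
    d x = B x · ω
    entry : ∀ {i j} → i ∈ ω → j ∈ ω → i ≢ j → B i j ≡ 1ℙ + pm B ω + (d i + d j)
    entry {i} {j} i∈ j∈ i≢j = sym (trans
      (cong (λ e → 1ℙ + e + (d i + d j)) (entry-from-degrees all-A s i∈ j∈ i≢j))
      (solve 2 (λ b e → con 1ℙ :+ (con 1ℙ :+ (b :+ e)) :+ e := b) refl (B i j) (d i + d j)))

  -- The triple τ is put into a set ω of size k + 2. All triples inside ω have equal minors, and one
  -- of them has minor 1, because removing two elements of ω leaves a nonzero minor of order k that
  -- shrinks to order 3.
  A-early⇒order-3 : ∀ {k} → 3 ≤ k → suc (suc k) ≤ n → Order B k A → Order B 3 A
  A-early⇒order-3 {k} 3≤k k+2≤n all-A {τ} t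
    with ω , τ⊆ω , s ← extend t (≤-trans 3≤k (m≤n+m k 2)) k+2≤n
    with x , x∈ ← element s
    with y , y∈ ← element (∖-size s x∈)
    with ψ , ψ⊆ , u , pm≡1 ← shrink (∖-size (∖-size s x∈) y∈) (all-A (∖-size (∖-size s x∈) y∈)) 3≤k
    = begin
    pm B τ ≡⟨ pm-triple-within all-A s τ⊆ω t ⟩
    pm B ω ≡⟨ pm-triple-within all-A s ψ⊆ω u ⟨
    pm B ψ ≡⟨ pm≡1 ⟩
    1ℙ     ∎
    where
    ψ⊆ω : ψ ⊆ ω
    ψ⊆ω {i} i∈ = proj₂ (∈-∖⁻ ω {i} {x} (proj₂ (∈-∖⁻ (ω ∖ x) {i} {y} (ψ⊆ i∈))))

  -- All degrees are odd, so the handshake lemma applies.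
  A-N⇒even : ∀ {m} → n ≡ suc m → Order B m A → Order B n N → parity n ≡ 0ℙ
  A-N⇒even refl all-A all-N = begin
    parity n
      ≡⟨ size-parity {n} full-size ⟨
    sum (lookup (full {n}))
      ≡⟨ (sum-cong-≗ λ i → trans (∈-full i) (sym (B-unit i))) ⟩
    (sum λ i → B i i)
      ≡⟨ sum-symmetric B B-sym ⟨
    (sum λ i → sum λ j → B i j)
      ≡⟨ (sum-zero λ i → trans (sum-cong-≗ λ j → sym (trans (cong (B i j *_) (∈-full j)) (*-identityʳ (B i j))))
           (trans (sym (contract-constant {full} (λ j j∈ → all-A (∖-size full-size {j} j∈)) (B i)))
             (trans (deletions full (∈-full i)) (all-N full-size)))) ⟩
    0ℙ ∎
    where
    ∈-full : ∀ i → i ∈ full {n}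
    ∈-full i = lookup-replicate i 1ℙ

-- Complete bipartite graphs

Bipartite : ∀ {n} → SquareMatrix n → (Fin n → Parity) → Set
Bipartite B d = ∀ i j → i ≢ j → B i j ≡ d i + d j

module _ {n} {B : SquareMatrix n} (B-sym : Symmetric B) (B-unit : UnitDiagonal B)
         {d : Fin n → Parity} (B-bip : Bipartite B d) where

  -- In the expansion along i, every term depends only on the size of the remaining set, its label
  -- sum and the labels of i and j. For odd k the value is 1; for even k it is 1 exactly when χ has
  -- an even number of vertices of label 1.
  pm-bipartite : ∀ {χ} k → χ HasSize k → pm B χ ≡ 1ℙ + (1ℙ + parity k) * (d · χ)
  pm-bipartite-∖ : ∀ {χ} k → χ HasSize k → ∀ {j} → j ∈ χ →
                   pm B (χ ∖ j) ≡ 1ℙ + parity k * (d · χ + d j)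

  pm-bipartite {χ} zero s = trans (pm-∅ B s) (sym (cong (1ℙ +_) (·-size-0 s d)))
  pm-bipartite {χ} (suc k) s with i , i∈ ← element s = begin
    pm B χ
      ≡⟨ expand B-sym B-unit χ i∈ ⟩
    pm B ψ + contract B (B i) ψ
      ≡⟨ cong₂ _+_ (pm-bipartite k (∖-size s i∈)) contract≡ ⟩
    1ℙ + (1ℙ + p) * D + (p * X + D * Y)
      ≡⟨ identity (d i) p D ⟩
    1ℙ + p * (d i + D)
      ≡⟨ cong₂ (λ x y → 1ℙ + x * y) 1+parity≡ (·-∖ χ i∈ d) ⟨
    1ℙ + (1ℙ + parity (suc k)) * (d · χ) ∎
    where
    ψ : Vec Parity n
    ψ = χ ∖ i
    p D X Y : Parity
    p = parity k
    D = d · ψ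
    -- A summand for j in ψ is `X + d j * Y`: a product of labels is affine in `d j`, since `d j` is
    -- 0 or 1.
    X = d i * (1ℙ + p * D)
    Y = d i * p + 1ℙ + p * D + p
    1+parity≡ : 1ℙ + parity (suc k) ≡ p
    1+parity≡ = suc-homo-⁻¹ k
    identity : ∀ a p D → 1ℙ + (1ℙ + p) * D + (p * (a * (1ℙ + p * D)) + D * (a * p + 1ℙ + p * D + p))
                       ≡ 1ℙ + p * (a + D)
    identity 0ℙ 0ℙ 0ℙ = refl
    identity 0ℙ 0ℙ 1ℙ = refl
    identity 0ℙ 1ℙ 0ℙ = refl
    identity 0ℙ 1ℙ 1ℙ = refl
    identity 1ℙ 0ℙ 0ℙ = refl
    identity 1ℙ 0ℙ 1ℙ = refl
    identity 1ℙ 1ℙ 0ℙ = refl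
    identity 1ℙ 1ℙ 1ℙ = refl
    label² : ∀ a b p D → (a + b) * (1ℙ + p * (D + b))
                         ≡ a * (1ℙ + p * D) + b * (a * p + 1ℙ + p * D + p)
    label² a 0ℙ p D = solve 3 (λ a p D → (a :+ con 0ℙ) :* (con 1ℙ :+ p :* (D :+ con 0ℙ))
                                 := a :* (con 1ℙ :+ p :* D) :+ con 0ℙ) refl a p D
    label² a 1ℙ p D = solve 3 (λ a p D → (a :+ con 1ℙ) :* (con 1ℙ :+ p :* (D :+ con 1ℙ))
                                 := a :* (con 1ℙ :+ p :* D) :+ (a :* p :+ con 1ℙ :+ p :* D :+ p)) refl a p D
    summand : ∀ j → B i j * (lookup ψ j * pm B (ψ ∖ j)) ≡ lookup ψ j * X + d j * lookup ψ j * Y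
    summand j with lookup ψ j in eq
    ... | 0ℙ = trans (*-zeroʳ (B i j)) (sym (cong (_* Y) (*-zeroʳ (d j))))
    ... | 1ℙ = begin
      B i j * pm B (ψ ∖ j)
        ≡⟨ cong₂ _*_ (B-bip i j (proj₁ (∈-∖⁻ χ eq) ∘ sym)) (pm-bipartite-∖ k (∖-size s i∈) eq) ⟩
      (d i + d j) * (1ℙ + p * (D + d j))
        ≡⟨ label² (d i) (d j) p D ⟩
      X + d j * Y
        ≡⟨ cong (λ x → X + x * Y) (*-identityʳ (d j)) ⟨
      X + d j * 1ℙ * Y ∎
    contract≡ : contract B (B i) ψ ≡ p * X + D * Y
    contract≡ = begin
      contract B (B i) ψ
        ≡⟨ sum-cong-≗ summand ⟩
      (sum λ j → lookup ψ j * X + d j * lookup ψ j * Y)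
        ≡⟨ ∑-distrib-+ (λ j → lookup ψ j * X) _ ⟩
      (sum λ j → lookup ψ j * X) + (sum λ j → d j * lookup ψ j * Y)
        ≡⟨ cong₂ _+_ (*-distribʳ-sum X (lookup ψ)) (*-distribʳ-sum Y (λ j → d j * lookup ψ j)) ⟨
      sum (lookup ψ) * X + D * Y
        ≡⟨ cong (λ x → x * X + D * Y) (size-parity (∖-size s i∈)) ⟩
      p * X + D * Y ∎

  pm-bipartite-∖ zero    s {j} j∈ = contradiction (trans (sym (size-0 s j)) j∈) 0≢1
  pm-bipartite-∖ {χ} (suc k) s {j} j∈ = begin
    pm B (χ ∖ j)
      ≡⟨ pm-bipartite k (∖-size s j∈) ⟩
    1ℙ + (1ℙ + parity k) * (d · (χ ∖ j))
      ≡⟨ cong₂ (λ x y → 1ℙ + x * y) (1+parity k) (sym D≡) ⟩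
    1ℙ + parity (suc k) * (d · χ + d j) ∎
    where
    D≡ : d · χ + d j ≡ d · (χ ∖ j)
    D≡ = trans (cong (_+ d j) (·-∖ χ j∈ d))
      (solve 2 (λ a b → a :+ b :+ a := b) refl (d j) (d · (χ ∖ j)))

-- Sequences starting with A

Letters : ∀ {n} → SquareMatrix n → ℕ → List Letter → Set
Letters B k []       = ⊤
Letters B k (l ∷ ls) = Order B k l × Letters B (suc k) ls

module _ {n} {B : SquareMatrix n} where

  -- The bound supplies a minor of order k; for larger k both `A` and `N` hold vacuously.
  order-unique : ∀ {k} l l′ → k ≤ n → Order B k l → Order B k l′ → l ≡ l′
  order-unique A A _ _ _ = refl
  order-unique A S _ a (_ , _ , s , e) = contradiction (trans (sym (a s)) e) 1≢0
  order-unique A N k≤n a b with _ , s ← sized k≤n = contradiction (trans (sym (a s)) (b s)) 1≢0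
  order-unique S A _ (_ , _ , s , e) b = contradiction (trans (sym (b s)) e) 1≢0
  order-unique S S _ _ _ = refl
  order-unique S N _ ((_ , s , e) , _) b = contradiction (trans (sym (b s)) e) 0≢1
  order-unique N A k≤n a b with _ , s ← sized k≤n = contradiction (trans (sym (a s)) (b s)) 0≢1
  order-unique N S _ a ((_ , s , e) , _) = contradiction (trans (sym (a s)) e) 0≢1
  order-unique N N _ _ _ = refl

  -- There is only one minor of order n.
  order-n-≢S : ¬ Order B n S
  order-n-≢S ((χ , s , e) , (ψ , t , f)) =
    1≢0 (trans (sym e) (trans (cong (pm B) (trans (size-full s) (sym (size-full t)))) f))

  private
    position≤n : ∀ {k m} → k ℕ.+ suc m ≡ suc n → k ≤ n
    position≤n {k} {m} eq = subst (k ≤_) (suc-injective (trans (sym (ℕ.+-suc k m)) eq)) (m≤m+n k m)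

  constant-letters : ∀ l k ls → (∀ {j} → k ≤ j → Order B j l) → Letters B k ls →
                     k ℕ.+ length ls ≡ suc n → ∃[ m ] ls ≡ repeat m [ l ]
  constant-letters l k [] _ _ _ = 0 , refl
  constant-letters l k (l′ ∷ ls) all-l (h , hs) eq
    with refl ← order-unique l′ l (position≤n eq) h (all-l ≤-refl)
    with m , refl ← constant-letters l (suc k) ls (λ k<j → all-l (≤-trans (n≤1+n k) k<j)) hs
                      (trans (sym (ℕ.+-suc k (length ls))) eq)
    = suc m , refl

  -- The letters S and A are forced, except at order n when n is even. There the letter is A or N,
  -- or else the sequence ends with an A of odd order, which gives three endings.
  alternating-letters : ∀ k ls → parity k ≡ 0ℙ →
    (∀ {j} → parity j ≡ 1ℙ → Order B j A) →
    (∀ {j} → k ≤ j → parity j ≡ 0ℙ → suc j ≤ n → Order B j S) →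
    Letters B k ls → k ℕ.+ length ls ≡ suc n →
    (∃[ m ] ls ≡ repeat m (S ∷ A ∷ [])) ⊎
    (∃[ m ] ls ≡ repeat m (S ∷ A ∷ []) ++ A ∷ []) ⊎
    (∃[ m ] ls ≡ repeat m (S ∷ A ∷ []) ++ N ∷ [])
  alternating-letters k [] _ _ _ _ _ = inj₁ (0 , refl)
  alternating-letters k (A ∷ []) _ _ _ _ _ = inj₂ (inj₁ (0 , refl))
  alternating-letters k (N ∷ []) _ _ _ _ _ = inj₂ (inj₂ (0 , refl))
  alternating-letters k (S ∷ []) _ _ _ (h , _) eq =
    contradiction (subst (λ k → Order B k S) k≡n h) order-n-≢S
    where
    k≡n : k ≡ n
    k≡n = suc-injective (trans (cong suc (sym (ℕ.+-identityʳ k))) (trans (sym (ℕ.+-suc k 0)) eq))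
  alternating-letters k (l ∷ l′ ∷ ls) k-even odd even (h , h′ , hs) eq
    with eq′ ← trans (sym (ℕ.+-suc k (suc (length ls)))) eq
    with refl ← order-unique l S (position≤n eq) h (even ≤-refl k-even (position≤n eq′))
    with refl ← order-unique l′ A (position≤n eq′) h′ (odd (trans (sym (1+parity k)) (cong (1ℙ +_) k-even)))
    with alternating-letters (suc (suc k)) ls k-even odd
           (even ∘ ≤-trans (≤-trans (n≤1+n k) (n≤1+n (suc k)))) hs (trans (cong suc (sym (ℕ.+-suc k (length ls)))) eq′)
  ... | inj₁ (m , refl)        = inj₁ (suc m , refl)
  ... | inj₂ (inj₁ (m , refl)) = inj₂ (inj₁ (suc m , refl))
  ... | inj₂ (inj₂ (m , refl)) = inj₂ (inj₂ (suc m , refl))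

odd-order-A : ∀ {n} {B : SquareMatrix n} → Symmetric B → UnitDiagonal B →
              ∀ {d} → Bipartite B d → ∀ {k} → parity k ≡ 1ℙ → Order B k A
odd-order-A B-sym B-unit {d} bip {k} k-odd {χ} s =
  trans (pm-bipartite B-sym B-unit bip k s) (cong (λ p → 1ℙ + (1ℙ + p) * (d · χ)) k-odd)

-- In a set ω of size k + 1 containing x and y, deleting x and deleting y give minors that differ,
-- because the labels of x and y do.
even-order-S : ∀ {n} {B : SquareMatrix n} → Symmetric B → UnitDiagonal B →
               ∀ {d} → Bipartite B d → ∀ {x y} → d x ≢ d y →
               ∀ {k} → 1 ≤ k → parity k ≡ 0ℙ → suc k ≤ n → Order B k S
even-order-S {n} {B} B-sym B-unit {d} bip {x} {y} dx≢dy {k} 1≤k k-even k<n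
  with p ← pair-isPair {i = x} {y} (dx≢dy ∘ cong d)
  with ω , p⊆ω , s ← extend (Pair.size p) (s≤s 1≤k) k<n
  = differ (d x) (d y) (d · ω) dx≢dy (value (p⊆ω (Pair.i∈ p))) (value (p⊆ω (Pair.j∈ p)))
  where
  value : ∀ {j} → j ∈ ω → ω ∖ j HasSize k × pm B (ω ∖ j) ≡ 1ℙ + (d · ω + d j)
  value {j} j∈ = ∖-size s j∈ , trans (pm-bipartite-∖ B-sym B-unit bip (suc k) s j∈)
    (cong (λ p → 1ℙ + p * (d · ω + d j)) (trans (sym (1+parity k)) (cong (1ℙ +_) k-even)))
  differ : ∀ a b e {χ ψ} → a ≢ b → χ HasSize k × pm B χ ≡ 1ℙ + (e + a) →
           ψ HasSize k × pm B ψ ≡ 1ℙ + (e + b) → Order B k S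
  differ 0ℙ 0ℙ _  a≢b _ _ = contradiction refl a≢b
  differ 1ℙ 1ℙ _  a≢b _ _ = contradiction refl a≢b
  differ 0ℙ 1ℙ 0ℙ _ (s , u) (t , v) = (_ , s , u) , (_ , t , v)
  differ 0ℙ 1ℙ 1ℙ _ (s , u) (t , v) = (_ , t , v) , (_ , s , u)
  differ 1ℙ 0ℙ 0ℙ _ (s , u) (t , v) = (_ , t , v) , (_ , s , u)
  differ 1ℙ 0ℙ 1ℙ _ (s , u) (t , v) = (_ , s , u) , (_ , t , v)

parity≡0⇒2∣ : ∀ n → parity n ≡ 0ℙ → 2 ∣ n
parity≡0⇒2∣ zero          _ = divides 0 refl
parity≡0⇒2∣ (suc (suc n)) e with divides q eq ← parity≡0⇒2∣ n e = divides (suc q) (cong (2 ℕ.+_) eq)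

module _ {n} {B : SquareMatrix n} (B-sym : Symmetric B) (B-unit : UnitDiagonal B) where

  -- The identity matrix counts as complete bipartite with all labels 0, so the formula for
  -- bipartite minors covers it.
  order-2-A⇒entries≡0 : Order B 2 A → Bipartite B (λ _ → 0ℙ)
  order-2-A⇒entries≡0 all-A i j i≢j = +-cancelˡ-≡ 1ℙ _ _
    (trans (sym (pm-pair B-sym B-unit p)) (all-A (Pair.size p)))
    where p = pair-isPair i≢j

  identity-order-A : Bipartite B (λ _ → 0ℙ) → ∀ {k} → Order B k A
  identity-order-A bip {k} {χ} s = trans (pm-bipartite B-sym B-unit {d = λ _ → 0ℙ} bip k s)
    (cong (1ℙ +_) (trans (cong ((1ℙ + parity k) *_) (sum-zero {n} λ _ → refl)) (*-zeroʳ (1ℙ + parity k))))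

  order-2-S⇒edge : Order B 2 S → ∃[ i ] ∃[ j ] i ≢ j × B i j ≡ 1ℙ
  order-2-S⇒edge (_ , χ , s , e) with i , j , p ← asPair s =
    i , j , Pair.i≢j p , +-cancelˡ-≡ 1ℙ _ _ (trans (sym (pm-pair B-sym B-unit p)) e)

  -- Here ls follows the letter S of order k. After N everything is N, an S continues the block and
  -- cannot be last, and an A leaves room for at most one more letter.
  letters-after-S : ∀ k ls → 3 ≤ k → Order B 3 S → Order B k S →
    Letters B (suc k) ls → k ℕ.+ length ls ≡ n →
    (∃[ m ] ∃[ p ] ls ≡ repeat m [ S ] ++ N ∷ repeat p [ N ]) ⊎
    (∃[ m ] ls ≡ repeat m [ S ] ++ A ∷ []) ⊎
    (∃[ m ] ls ≡ repeat m [ S ] ++ A ∷ A ∷ []) ⊎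
    ((∃[ m ] ls ≡ repeat m [ S ] ++ A ∷ N ∷ []) × 2 ∣ n)
  letters-after-S k [] _ _ all-S _ eq =
    contradiction (subst (λ k → Order B k S) (trans (sym (ℕ.+-identityʳ k)) eq) all-S) (order-n-≢S {B = B})
  letters-after-S k (N ∷ ls) _ _ _ (h , hs) eq
    with p , refl ← constant-letters {B = B} N (suc (suc k)) ls
           (λ k<j → N-persists B-sym B-unit (≤-trans (n≤1+n (suc k)) k<j) h) hs
           (cong suc (trans (sym (ℕ.+-suc k (length ls))) eq))
    = inj₁ (0 , p , refl)
  letters-after-S k (S ∷ ls) 3≤k h₃ _ (h , hs) eq
    with letters-after-S (suc k) ls (≤-trans 3≤k (n≤1+n k)) h₃ h hs (trans (sym (ℕ.+-suc k (length ls))) eq)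
  ... | inj₁ (m , p , refl)                     = inj₁ (suc m , p , refl)
  ... | inj₂ (inj₁ (m , refl))                  = inj₂ (inj₁ (suc m , refl))
  ... | inj₂ (inj₂ (inj₁ (m , refl)))           = inj₂ (inj₂ (inj₁ (suc m , refl)))
  ... | inj₂ (inj₂ (inj₂ ((m , refl) , 2∣n)))   = inj₂ (inj₂ (inj₂ ((suc m , refl) , 2∣n)))
  letters-after-S k (A ∷ []) _ _ _ _ _ = inj₂ (inj₁ (0 , refl))
  letters-after-S k (A ∷ A ∷ []) _ _ _ _ _ = inj₂ (inj₂ (inj₁ (0 , refl)))
  letters-after-S k (A ∷ S ∷ []) _ _ _ (_ , h , _) eq =
    contradiction (subst (λ k → Order B k S) (trans (ℕ.+-comm 2 k) eq) h) (order-n-≢S {B = B})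
  letters-after-S k (A ∷ N ∷ []) _ _ _ (h , h′ , _) eq =
    inj₂ (inj₂ (inj₂ ((0 , refl) , parity≡0⇒2∣ n
      (A-N⇒even B-sym B-unit (sym k+2≡n) h (subst (λ k → Order B k N) k+2≡n h′)))))
    where
    k+2≡n : suc (suc k) ≡ n
    k+2≡n = trans (ℕ.+-comm 2 k) eq
  letters-after-S k (A ∷ l ∷ l′ ∷ ls) 3≤k h₃ _ (h , _) eq =
    -- Two letters follow the A of order k + 1, so this A is early enough to force A at order 3.
    contradiction (order-unique {B = B} A S (≤-trans (≤-trans 3≤k (m≤n+m k 3)) k+3≤n)
      (A-early⇒order-3 B-sym B-unit (≤-trans 3≤k (n≤1+n k)) k+3≤n h) h₃) λ ()
    where
    k+3≤n : suc (suc (suc k)) ≤ n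
    k+3≤n = subst (suc (suc (suc k)) ≤_)
      (trans (sym (trans (ℕ.+-suc k _) (cong suc (trans (ℕ.+-suc k _) (cong suc (ℕ.+-suc k _)))))) eq)
      (s≤s (s≤s (s≤s (m≤m+n k (length ls)))))

-- The labels are the adjacencies to the first vertex, which itself gets label 0. A triple of minor
-- 1 has an even number of edges, so the entry at i, j is the sum of the entries joining i and j to
-- the first vertex.
order-3-A⇒bipartite : ∀ {n} {B : SquareMatrix (suc n)} → Symmetric B → UnitDiagonal B →
                      Order B 3 A → ∃[ d ] Bipartite B d
order-3-A⇒bipartite {n} {B} B-sym B-unit all-A = d , bip
  where
  d : Fin (suc n) → Parity
  d zero    = 0ℙ
  d (suc j) = B zero (suc j)
  bip : Bipartite B d
  bip zero    zero    i≢j = contradiction refl i≢j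
  bip zero    (suc j) i≢j = refl
  bip (suc i) zero    i≢j = trans (B-sym (suc i) zero)
    (solve 1 (λ b → b := b :+ con 0ℙ) refl (B zero (suc i)))
  bip (suc i) (suc j) i≢j = begin
    c
      ≡⟨ solve 3 (λ a b c → c := a :+ b :+ (con 1ℙ :+ (con 1ℙ :+ (a :+ (b :+ c))))) refl a b c ⟩
    a + b + (1ℙ + (1ℙ + (a + (b + c))))
      ≡⟨ cong (λ x → a + b + (1ℙ + x)) (trans (sym (pm-triple B-sym B-unit t)) (all-A (Triple.size t))) ⟩
    a + b + 0ℙ
      ≡⟨ solve 2 (λ a b → a :+ b :+ con 0ℙ := a :+ b) refl a b ⟩
    a + b ∎
    where
    a = B zero (suc i)
    b = B zero (suc j)
    c = B (suc i) (suc j)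
    t = triple-isTriple {i = zero} {suc i} {suc j} (λ ()) (λ ()) i≢j

-- Necessity of the forms

HasForm : ℕ → List Letter → Set
HasForm n ls =
    (∃[ m ] ls ≡ A ∷ repeat m [ A ])
  ⊎ (∃[ m ] ∃[ p ] ls ≡ A ∷ repeat m [ S ] ++ N ∷ repeat p [ N ])
  ⊎ (∃[ m ] ls ≡ A ∷ S ∷ S ∷ repeat m [ S ] ++ A ∷ [])
  ⊎ (∃[ m ] ls ≡ A ∷ S ∷ S ∷ repeat m [ S ] ++ A ∷ A ∷ [])
  ⊎ ((∃[ m ] ls ≡ A ∷ S ∷ S ∷ S ∷ repeat m [ S ] ++ A ∷ N ∷ []) × 2 ∣ n)
  ⊎ (∃[ m ] ls ≡ A ∷ S ∷ A ∷ repeat m (S ∷ A ∷ []))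
  ⊎ (∃[ m ] ls ≡ A ∷ S ∷ A ∷ repeat m (S ∷ A ∷ []) ++ A ∷ [])
  ⊎ (∃[ m ] ls ≡ A ∷ S ∷ A ∷ repeat m (S ∷ A ∷ []) ++ N ∷ [])

pattern form₁ x = inj₁ x
pattern form₂ x = inj₂ (inj₁ x)
pattern form₃ x = inj₂ (inj₂ (inj₁ x))
pattern form₄ x = inj₂ (inj₂ (inj₂ (inj₁ x)))
pattern form₅ x = inj₂ (inj₂ (inj₂ (inj₂ (inj₁ x))))
pattern form₆ x = inj₂ (inj₂ (inj₂ (inj₂ (inj₂ (inj₁ x)))))
pattern form₇ x = inj₂ (inj₂ (inj₂ (inj₂ (inj₂ (inj₂ (inj₁ x))))))
pattern form₈ x = inj₂ (inj₂ (inj₂ (inj₂ (inj₂ (inj₂ (inj₂ x))))))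

¬2∣5 : ¬ 2 ∣ 5
¬2∣5 (divides (suc (suc (suc _))) ())

unitDiagonal : ∀ {n} {B : SquareMatrix n} → HasLetter B 1 A → UnitDiagonal B
unitDiagonal all-A i = ≢0⇒≡1 λ Bᵢᵢ≡0 →
  all-A ((λ _ → i) , λ { {zero} {zero} () }) (cong (λ b → b * 1ℙ + 0ℙ) Bᵢᵢ≡0)

-- The S at order 2 supplies an edge, whose ends have different labels. So both classes are nonempty
-- and the letters at even orders below n are S.
letters-ASA : ∀ {n} {B : SquareMatrix (suc n)} → Symmetric B → UnitDiagonal B →
  Order B 2 S → Order B 3 A → ∀ ls → Letters B 4 ls → 2 ℕ.+ length ls ≡ n →
  (∃[ m ] ls ≡ repeat m (S ∷ A ∷ [])) ⊎
  (∃[ m ] ls ≡ repeat m (S ∷ A ∷ []) ++ A ∷ []) ⊎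
  (∃[ m ] ls ≡ repeat m (S ∷ A ∷ []) ++ N ∷ [])
letters-ASA {B = B} B-sym B-unit h₂ h₃ ls hs eq =
  let d , bip = order-3-A⇒bipartite B-sym B-unit h₃
      i , j , i≢j , Bᵢⱼ≡1 = order-2-S⇒edge B-sym B-unit h₂
      dᵢ≢dⱼ : d i ≢ d j
      dᵢ≢dⱼ dᵢ≡dⱼ = 0≢1 (trans (sym (p+p≡0ℙ (d j)))
        (trans (cong (_+ d j) (sym dᵢ≡dⱼ)) (trans (sym (bip i j i≢j)) Bᵢⱼ≡1)))
  in alternating-letters {B = B} 4 ls refl
       (λ {k} → odd-order-A B-sym B-unit {d} bip {k})
       (λ 4≤k → even-order-S B-sym B-unit {d} bip {i} {j} dᵢ≢dⱼ (≤-trans (s≤s z≤n) 4≤k))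
       hs (cong (2 ℕ.+_) eq)

necessity : ∀ {n} {B : SquareMatrix (suc n)} → Symmetric B → UnitDiagonal B → ∀ ls → length ls ≡ n →
            Letters B 2 ls → HasForm (suc n) (A ∷ ls)
necessity B-sym B-unit [] _ _ = form₁ (0 , refl)
necessity {B = B} B-sym B-unit (A ∷ ls) eq (h₂ , hs) = finish
  (constant-letters {B = B} A 3 ls
    (λ _ → identity-order-A B-sym B-unit (order-2-A⇒entries≡0 B-sym B-unit h₂)) hs
    (cong (2 ℕ.+_) eq))
  where
  finish : ∃[ m ] ls ≡ repeat m [ A ] → HasForm _ (A ∷ A ∷ ls)
  finish (m , refl) = form₁ (suc m , refl)
necessity {B = B} B-sym B-unit (N ∷ ls) eq (h₂ , hs) = finish
  (constant-letters {B = B} N 3 ls (λ 3≤k → N-persists B-sym B-unit (≤-trans (n≤1+n 2) 3≤k) h₂) hs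
    (cong (2 ℕ.+_) eq))
  where
  finish : ∃[ p ] ls ≡ repeat p [ N ] → HasForm _ (A ∷ N ∷ ls)
  finish (p , refl) = form₂ (0 , p , refl)
necessity {B = B} B-sym B-unit (S ∷ []) refl (h₂ , _) = contradiction h₂ (order-n-≢S {B = B})
necessity {B = B} B-sym B-unit (S ∷ N ∷ ls) eq (_ , h₃ , hs) = finish
  (constant-letters {B = B} N 4 ls (λ 4≤k → N-persists B-sym B-unit (≤-trans (n≤1+n 3) 4≤k) h₃) hs
    (cong (2 ℕ.+_) eq))
  where
  finish : ∃[ p ] ls ≡ repeat p [ N ] → HasForm _ (A ∷ S ∷ N ∷ ls)
  finish (p , refl) = form₂ (1 , p , refl)
necessity {B = B} B-sym B-unit (S ∷ A ∷ ls) eq (h₂ , h₃ , hs) = finish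
  (letters-ASA B-sym B-unit h₂ h₃ ls hs eq)
  where
  finish : _ → HasForm _ (A ∷ S ∷ A ∷ ls)
  finish (inj₁ (m , refl))        = form₆ (m , refl)
  finish (inj₂ (inj₁ (m , refl))) = form₇ (m , refl)
  finish (inj₂ (inj₂ (m , refl))) = form₈ (m , refl)
necessity {n} B-sym B-unit (S ∷ S ∷ ls) eq (_ , h₃ , hs) = finish eq
  (letters-after-S B-sym B-unit 3 ls ≤-refl h₃ h₃ hs (cong suc eq))
  where
  finish : 2 ℕ.+ length ls ≡ n → _ → HasForm (suc n) (A ∷ S ∷ S ∷ ls)
  finish _ (inj₁ (m , p , refl))           = form₂ (suc (suc m) , p , refl)
  finish _ (inj₂ (inj₁ (m , refl)))        = form₃ (m , refl)
  finish _ (inj₂ (inj₂ (inj₁ (m , refl)))) = form₄ (m , refl)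
  -- This would be `ASSAN`, whose order 5 is odd.
  finish eq (inj₂ (inj₂ (inj₂ ((zero , refl) , 2∣n)))) =
    contradiction (subst (λ n → 2 ∣ suc n) (sym eq) 2∣n) ¬2∣5
  finish _ (inj₂ (inj₂ (inj₂ ((suc m , refl) , 2∣n)))) = form₅ ((m , refl) , 2∣n)

-- Realising the forms

addVertex : ∀ {n} → (Fin n → Parity) → SquareMatrix n → SquareMatrix (suc n)
addVertex w B zero    zero    = 1ℙ
addVertex w B zero    (suc j) = w j
addVertex w B (suc i) zero    = w i
addVertex w B (suc i) (suc j) = B i j

addVertex-sym : ∀ {n w} {B : SquareMatrix n} → Symmetric B → Symmetric (addVertex w B)
addVertex-sym B-sym zero    zero    = refl
addVertex-sym B-sym zero    (suc j) = refl
addVertex-sym B-sym (suc i) zero    = refl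
addVertex-sym B-sym (suc i) (suc j) = B-sym i j

addVertex-unit : ∀ {n w} {B : SquareMatrix n} → UnitDiagonal B → UnitDiagonal (addVertex w B)
addVertex-unit B-unit zero    = refl
addVertex-unit B-unit (suc i) = B-unit i

δ : ∀ {n} → Fin n → Fin n → Parity
δ zero    zero    = 1ℙ
δ zero    (suc j) = 0ℙ
δ (suc i) zero    = 0ℙ
δ (suc i) (suc j) = δ i j

sum-δ : ∀ {n} (i : Fin n) (g : Fin n → Parity) → (sum λ j → δ i j * g j) ≡ g i
sum-δ {suc n} zero    g = trans (cong (g zero +_) (sum-zero {n} λ _ → refl)) (+-identityʳ (g zero))
sum-δ         (suc i) g = sum-δ i (g ∘ suc)

-- Isolated vertices and leaves

addIsolated : ∀ {n} → SquareMatrix n → SquareMatrix (suc n)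
addIsolated = addVertex λ _ → 0ℙ

pm-addIsolated : ∀ {n} (B : SquareMatrix n) χ → pm (addIsolated B) (1ℙ ∷ χ) ≡ pm B χ
pm-addIsolated {n} B χ = trans (cong (pm B χ +_) (sum-zero {n} λ _ → refl)) (+-identityʳ (pm B χ))

-- The two terms count the matchings that leave the new leaf unmatched and those that match it to v.
pm-addLeaf : ∀ {n} (B : SquareMatrix n) v χ →
             pm (addVertex (δ v) B) (1ℙ ∷ χ) ≡ pm B χ + lookup χ v * pm B (χ ∖ v)
pm-addLeaf B v χ = cong (pm B χ +_) (sum-δ v (λ j → lookup χ j * pm B (χ ∖ j)))

add2Leaves : ∀ {n} → Fin n → SquareMatrix n → SquareMatrix (suc (suc n))
add2Leaves v B = addVertex (δ (suc v)) (addVertex (δ v) B)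

-- The matchings using exactly one of the two pendant edges cancel.
pm-add2Leaves : ∀ {n} (B : SquareMatrix n) v χ → pm (add2Leaves v B) (1ℙ ∷ 1ℙ ∷ χ) ≡ pm B χ
pm-add2Leaves B v χ = begin
  pm (add2Leaves v B) (1ℙ ∷ 1ℙ ∷ χ)
    ≡⟨ pm-addLeaf (addVertex (δ v) B) (suc v) (1ℙ ∷ χ) ⟩
  pm (addVertex (δ v) B) (1ℙ ∷ χ) + x * pm (addVertex (δ v) B) (1ℙ ∷ (χ ∖ v))
    ≡⟨ cong₂ (λ a b → a + x * b) (pm-addLeaf B v χ) (pm-addLeaf B v (χ ∖ v)) ⟩
  p + x * q + x * (q + lookup (χ ∖ v) v * r)
    ≡⟨ cong (λ y → p + x * q + x * (q + y * r)) (lookup∘update v χ 0ℙ) ⟩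
  p + x * q + x * (q + 0ℙ)
    ≡⟨ solve 3 (λ p x q → p :+ x :* q :+ x :* (q :+ con 0ℙ) := p) refl p x q ⟩
  p ∎
  where
  x = lookup χ v
  p = pm B χ
  q = pm B (χ ∖ v)
  r = pm B (χ ∖ v ∖ v)

-- The range starts at 2 because all minors of order 1 are 1 for a unit diagonal.
Zeros : ∀ {n} → SquareMatrix n → ℕ → Set
Zeros B h = ∀ {k} → 2 ≤ k → k ≤ h → ∃[ χ ] χ HasSize k × pm B χ ≡ 0ℙ

-- The new order h + 1 is reached by joining the isolated vertex to a zero set of size h.
addIsolated-zeros : ∀ {n h} {B : SquareMatrix n} → 2 ≤ h → Zeros B h → Zeros (addIsolated B) (suc h)
addIsolated-zeros {h = h} {B} 2≤h zeros 2≤k k≤1+h with m≤n⇒m<n∨m≡n k≤1+h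
... | inj₁ (s≤s k≤h) = let χ , s , e = zeros 2≤k k≤h in 0ℙ ∷ χ , skip s , e
... | inj₂ refl      = let χ , s , e = zeros 2≤h ≤-refl in 1ℙ ∷ χ , keep s , trans (pm-addIsolated B χ) e

order-n : ∀ {n p} {B : SquareMatrix n} → pm B full ≡ p → ∀ {χ} → χ HasSize n → pm B χ ≡ p
order-n e s = trans (cong (pm _) (size-full s)) e

size-n-1 : ∀ {n} {χ : Vec Parity (suc n)} → χ HasSize n → ∃[ i ] χ ≡ full ∖ i
size-n-1 (skip s)           = zero , cong (0ℙ ∷_) (size-full s)
size-n-1 {suc n} (keep s) = let i , χ≡ = size-n-1 s in suc i , cong (1ℙ ∷_) χ≡

order-n-1 : ∀ {n p} {B : SquareMatrix (suc n)} → (∀ i → pm B (full ∖ i) ≡ p) →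
            ∀ {χ} → χ HasSize n → pm B χ ≡ p
order-n-1 {B = B} e s = let i , χ≡ = size-n-1 s in trans (cong (pm B) χ≡) (e i)

addIsolated-order-A : ∀ {n k} {B : SquareMatrix n} → Order B (suc k) A → Order B k A →
                      Order (addIsolated B) (suc k) A
addIsolated-order-A         all-A all-A′ (skip s)         = all-A s
addIsolated-order-A {B = B} all-A all-A′ (keep {χ = χ} s) = trans (pm-addIsolated B χ) (all-A′ s)

addIsolated-order-N : ∀ {n k} {B : SquareMatrix n} → Order B (suc k) N → Order B k N →
                      Order (addIsolated B) (suc k) N
addIsolated-order-N         all-N all-N′ (skip s)         = all-N s
addIsolated-order-N {B = B} all-N all-N′ (keep {χ = χ} s) = trans (pm-addIsolated B χ) (all-N′ s)

addIsolated-order-n : ∀ {n} {B : SquareMatrix n} → Order B n A → Order (addIsolated B) (suc n) A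
-- The old matrix has no minor of order n + 1, so only sets with the new vertex count.
addIsolated-order-n {n} all-A = addIsolated-order-A (λ s → contradiction (size-≤ s) 1+n≰n) all-A

module _ {n} {B : SquareMatrix n} where

  -- A single nonzero minor of order h yields nonzero minors of all smaller orders by shrinking.
  order-S : Symmetric B → UnitDiagonal B → ∀ {h} → Zeros B h → (∃[ χ ] χ HasSize h × pm B χ ≡ 1ℙ) →
            ∀ {k} → 2 ≤ k → k ≤ h → Order B k S
  order-S B-sym B-unit zeros (χ , s , e) 2≤k k≤h =
    let ψ , _ , t , f = shrink B-sym B-unit s e k≤h in (ψ , t , f) , zeros 2≤k k≤h

  constant-block : ∀ l m k → (∀ {j} → k ≤ j → Order B j l) → Letters B k (repeat m [ l ])
  constant-block l zero    k all-l = tt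
  constant-block l (suc m) k all-l =
    all-l ≤-refl , constant-block l m (suc k) (λ k<j → all-l (≤-trans (n≤1+n k) k<j))

  S-block : ∀ m k {ls} → (∀ {j} → k ≤ j → j < k ℕ.+ m → Order B j S) →
            Letters B (k ℕ.+ m) ls → Letters B k (repeat m [ S ] ++ ls)
  S-block zero    k {ls} all-S hs = subst (λ j → Letters B j ls) (ℕ.+-identityʳ k) hs
  S-block (suc m) k {ls} all-S hs =
    all-S ≤-refl (subst (k <_) (sym (ℕ.+-suc k m)) (s≤s (m≤m+n k m))) ,
    S-block m (suc k) (λ {j} k<j j< → all-S (≤-trans (n≤1+n k) k<j) (subst (j <_) (sym (ℕ.+-suc k m)) j<))
      (subst (λ j → Letters B j ls) (ℕ.+-suc k m) hs)

  SA-block : ∀ m k {ls} → parity k ≡ 0ℙ → (∀ {j} → parity j ≡ 1ℙ → Order B j A) →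
             (∀ {j} → k ≤ j → parity j ≡ 0ℙ → suc j ≤ n → Order B j S) →
             k ℕ.+ m ℕ.* 2 ≤ suc n → Letters B (k ℕ.+ m ℕ.* 2) ls →
             Letters B k (repeat m (S ∷ A ∷ []) ++ ls)
  SA-block zero    k {ls} _ _ _ _ hs = subst (λ j → Letters B j ls) (ℕ.+-identityʳ k) hs
  SA-block (suc m) k {ls} k-even odd even ≤1+n hs =
    even ≤-refl k-even (s≤s⁻¹ (≤-trans (m≤m+n (suc (suc k)) (m ℕ.* 2)) ≤1+n′)) ,
    odd {suc k} (trans (sym (1+parity k)) (cong (1ℙ +_) k-even)) ,
    SA-block m (suc (suc k)) k-even (λ {j} → odd {j})
      (even ∘ ≤-trans (≤-trans (n≤1+n k) (n≤1+n (suc k)))) ≤1+n′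
      (subst (λ j → Letters B j ls) k+2 hs)
    where
    k+2 : k ℕ.+ suc (suc (m ℕ.* 2)) ≡ suc (suc (k ℕ.+ m ℕ.* 2))
    k+2 = trans (ℕ.+-suc k _) (cong suc (ℕ.+-suc k _))
    ≤1+n′ : suc (suc (k ℕ.+ m ℕ.* 2)) ≤ suc n
    ≤1+n′ = subst (_≤ suc n) k+2 ≤1+n

record Realisable (n : ℕ) (ls : List Letter) : Set where
  constructor realised
  field
    matrix    : SquareMatrix n
    symmetric : Symmetric matrix
    letters   : Letters matrix 1 ls

-- Forms realised by complete bipartite graphs

bipartite : ∀ {n} → (Fin n → Parity) → SquareMatrix n
bipartite {suc n} d = addVertex (λ j → d zero + d (suc j)) (bipartite (d ∘ suc))

bipartite-sym : ∀ {n} (d : Fin n → Parity) → Symmetric (bipartite d)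
bipartite-sym {suc n} d = addVertex-sym (bipartite-sym (d ∘ suc))

bipartite-unit : ∀ {n} (d : Fin n → Parity) → UnitDiagonal (bipartite d)
bipartite-unit {suc n} d = addVertex-unit (bipartite-unit (d ∘ suc))

bipartite-bip : ∀ {n} (d : Fin n → Parity) → Bipartite (bipartite d) d
bipartite-bip {suc n} d zero    zero    i≢j = contradiction refl i≢j
bipartite-bip {suc n} d zero    (suc j) i≢j = refl
bipartite-bip {suc n} d (suc i) zero    i≢j = +-comm (d zero) (d (suc i))
bipartite-bip {suc n} d (suc i) (suc j) i≢j = bipartite-bip (d ∘ suc) i j (i≢j ∘ cong suc)

all-A-realisable : ∀ m → Realisable (suc m) (A ∷ repeat m [ A ])
all-A-realisable m = realised (bipartite d) (bipartite-sym d) (constant-block {B = bipartite d} A (suc m) 1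
  (λ _ → identity-order-A (bipartite-sym d) (bipartite-unit d) (bipartite-bip d)))
  where
  d : Fin (suc m) → Parity
  d _ = 0ℙ

module _ {n} (d : Fin n → Parity) {x y} (dx≢dy : d x ≢ d y) where

  -- The two orders belong to the sequence that stops after the blocks and to the one with a single
  -- further letter, at the even order n.
  ASA-letters : ∀ m {ls} → n ≡ 3 ℕ.+ m ℕ.* 2 ⊎ n ≡ 4 ℕ.+ m ℕ.* 2 →
                Letters (bipartite d) (4 ℕ.+ m ℕ.* 2) ls →
                Letters (bipartite d) 1 (A ∷ S ∷ A ∷ repeat m (S ∷ A ∷ []) ++ ls)
  ASA-letters m n≡ hs = odd {1} refl , even {2} (s≤s z≤n) refl (3≤n n≡) , odd {3} refl ,
    SA-block m 4 refl (λ {j} → odd {j}) (λ 4≤j → even (≤-trans (s≤s z≤n) 4≤j)) (bound n≡) hs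
    where
    odd : ∀ {j} → parity j ≡ 1ℙ → Order (bipartite d) j A
    odd {j} = odd-order-A (bipartite-sym d) (bipartite-unit d) {d} (bipartite-bip d) {j}
    even : ∀ {j} → 1 ≤ j → parity j ≡ 0ℙ → suc j ≤ n → Order (bipartite d) j S
    even = even-order-S (bipartite-sym d) (bipartite-unit d) {d} (bipartite-bip d) {x} {y} dx≢dy
    3≤n : n ≡ 3 ℕ.+ m ℕ.* 2 ⊎ n ≡ 4 ℕ.+ m ℕ.* 2 → 3 ≤ n
    3≤n (inj₁ refl) = s≤s (s≤s (s≤s z≤n))
    3≤n (inj₂ refl) = s≤s (s≤s (s≤s z≤n))
    bound : n ≡ 3 ℕ.+ m ℕ.* 2 ⊎ n ≡ 4 ℕ.+ m ℕ.* 2 → 4 ℕ.+ m ℕ.* 2 ≤ suc n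
    bound (inj₁ refl) = ≤-refl
    bound (inj₂ refl) = n≤1+n _

pm-bipartite-full : ∀ {n} (d : Fin n → Parity) → parity n ≡ 0ℙ →
                    ∀ {χ} → χ HasSize n → pm (bipartite d) χ ≡ 1ℙ + d · full
pm-bipartite-full {n} d n-even {χ} s = trans
  (pm-bipartite (bipartite-sym d) (bipartite-unit d) {d} (bipartite-bip d) n s)
  (cong₂ (λ p ψ → 1ℙ + (1ℙ + p) * (d · ψ)) n-even (size-full s))

parity-*2 : ∀ m → parity (m ℕ.* 2) ≡ 0ℙ
parity-*2 zero    = refl
parity-*2 (suc m) = parity-*2 m

ones : ∀ {n} → ℕ → Fin n → Parity
ones zero    _       = 0ℙ
ones (suc k) zero    = 1ℙ
ones (suc k) (suc i) = ones k i

ones·full : ∀ n k → ones {k ℕ.+ n} k · full ≡ parity k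
ones·full n zero    = sum-zero {n} λ _ → refl
ones·full n (suc k) = trans (cong _⁻¹ (ones·full n k)) (1+parity k)

ASA-realisable : ∀ m → Realisable (3 ℕ.+ m ℕ.* 2) (A ∷ S ∷ A ∷ repeat m (S ∷ A ∷ []) ++ [])
ASA-realisable m = realised (bipartite d) (bipartite-sym d)
  (ASA-letters d {zero} {suc zero} (λ ()) m (inj₁ refl) tt)
  where
  d : Fin (3 ℕ.+ m ℕ.* 2) → Parity
  d = ones 1

ASAA-realisable : ∀ m → Realisable (4 ℕ.+ m ℕ.* 2) (A ∷ S ∷ A ∷ repeat m (S ∷ A ∷ []) ++ A ∷ [])
ASAA-realisable m = realised (bipartite d) (bipartite-sym d)
  (ASA-letters d {zero} {suc (suc zero)} (λ ()) m (inj₂ refl)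
    ((λ {χ} s → trans (pm-bipartite-full d (parity-*2 m) s)
              (cong (1ℙ +_) (ones·full (2 ℕ.+ m ℕ.* 2) 2))) , tt))
  where
  d : Fin (4 ℕ.+ m ℕ.* 2) → Parity
  -- A class of even size makes the minor of the even order n equal to 1.
  d = ones 2

ASAN-realisable : ∀ m → Realisable (4 ℕ.+ m ℕ.* 2) (A ∷ S ∷ A ∷ repeat m (S ∷ A ∷ []) ++ N ∷ [])
ASAN-realisable m = realised (bipartite d) (bipartite-sym d)
  (ASA-letters d {zero} {suc zero} (λ ()) m (inj₂ refl)
    ((λ {χ} s → trans (pm-bipartite-full d (parity-*2 m) s)
              (cong (1ℙ +_) (ones·full (3 ℕ.+ m ℕ.* 2) 1))) , tt))
  where
  d : Fin (4 ℕ.+ m ℕ.* 2) → Parity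
  -- A class of odd size makes the minor of the even order n equal to 0.
  d = ones 1

-- A clique on p + 2 vertices with m isolated vertices. The nonzero minor of order m + 1 comes from
-- the isolated vertices and one vertex of the clique.
record Form₂ (p m : ℕ) : Set where
  field
    B       : SquareMatrix (2 ℕ.+ m ℕ.+ p)
    B-sym   : Symmetric B
    B-unit  : UnitDiagonal B
    zeros   : Zeros B (2 ℕ.+ m)
    nonzero : ∃[ χ ] χ HasSize suc m × pm B χ ≡ 1ℙ
    all-N   : Order B (2 ℕ.+ m) N

form₂-matrix : ∀ p m → Form₂ p m
form₂-matrix p zero = record
  { B = J ; B-sym = λ _ _ → refl ; B-unit = λ _ → refl
  ; zeros = λ { {k} 2≤k k≤2 → let χ , s = sized (≤-trans k≤2 (s≤s (s≤s z≤n))) in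
                χ , s , N-persists {B = J} (λ _ _ → refl) (λ _ → refl) 2≤k all-N s }
  ; nonzero = let χ , s = sized (s≤s z≤n) in
              χ , s , order-1 {B = J} (λ _ _ → refl) (λ _ → refl) s
  ; all-N = all-N }
  where
  J : SquareMatrix (2 ℕ.+ p)
  J _ _ = 1ℙ
  all-N : Order J 2 N
  all-N s = let _ , _ , q = asPair s in pm-pair {B = J} (λ _ _ → refl) (λ _ → refl) q
form₂-matrix p (suc m) = record
  { B = addIsolated B
  ; B-sym = addVertex-sym B-sym ; B-unit = addVertex-unit B-unit
  ; zeros = addIsolated-zeros {B = B} (s≤s (s≤s z≤n)) zeros
  ; nonzero = let χ , s , e = nonzero in 1ℙ ∷ χ , keep s , trans (pm-addIsolated B χ) e
  ; all-N = addIsolated-order-N {B = B} (N-persists B-sym B-unit (n≤1+n (2 ℕ.+ m)) all-N) all-N }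
  where open Form₂ (form₂-matrix p m)

ASN-realisable : ∀ m p → Realisable (2 ℕ.+ m ℕ.+ p) (A ∷ repeat m [ S ] ++ N ∷ repeat p [ N ])
ASN-realisable m p = realised B B-sym (order-1 B-sym B-unit ,
  S-block m 2 (λ 2≤j j<2+m → order-S B-sym B-unit
      (λ 2≤k k≤1+m → zeros 2≤k (≤-trans k≤1+m (n≤1+n (suc m)))) nonzero 2≤j (s≤s⁻¹ j<2+m))
    (constant-block {B = B} N (suc p) (2 ℕ.+ m) (λ 2+m≤j → N-persists B-sym B-unit 2+m≤j all-N)))
  where open Form₂ (form₂-matrix p m)

nonzero-below : ∀ {n k} {B : SquareMatrix n} → Symmetric B → UnitDiagonal B → suc k ≤ n →
                Order B (suc k) A → ∃[ χ ] χ HasSize k × pm B χ ≡ 1ℙ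
nonzero-below {k = k} {B} B-sym B-unit k<n all-A =
  let χ , s = sized k<n
      ψ , _ , t , e = shrink B-sym B-unit s (all-A s) (n≤1+n k)
  in ψ , t , e

-- A path on 3 vertices, which has 3 matchings, with m isolated vertices.
record Form₃ (m : ℕ) : Set where
  field
    B       : SquareMatrix (3 ℕ.+ m)
    B-sym   : Symmetric B
    B-unit  : UnitDiagonal B
    zeros   : Zeros B (2 ℕ.+ m)
    order-n-A : Order B (3 ℕ.+ m) A

singleton : SquareMatrix 1
singleton = addVertex (λ ()) (λ ())

singleton-sym : Symmetric singleton
singleton-sym = addVertex-sym (λ ())

singleton-unit : UnitDiagonal singleton
singleton-unit = addVertex-unit {B = λ ()} (λ ())

path : SquareMatrix 3
path = addVertex (δ zero) (addVertex (δ zero) singleton)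

path-sym : Symmetric path
path-sym = addVertex-sym (addVertex-sym singleton-sym)

path-unit : UnitDiagonal path
path-unit = addVertex-unit (addVertex-unit singleton-unit)

form₃-matrix : ∀ m → Form₃ m
form₃-matrix zero = record
  { B = path ; B-sym = path-sym ; B-unit = path-unit
  ; zeros = λ { (s≤s (s≤s z≤n)) (s≤s (s≤s z≤n)) → 1ℙ ∷ 1ℙ ∷ 0ℙ ∷ [] , keep (keep (skip [])) , refl }
  ; order-n-A = order-n {B = path} refl }
form₃-matrix (suc m) = record
  { B = addIsolated B
  ; B-sym = addVertex-sym B-sym ; B-unit = addVertex-unit B-unit
  ; zeros = addIsolated-zeros {B = B} (s≤s (s≤s z≤n)) zeros
  ; order-n-A = addIsolated-order-n {B = B} order-n-A }
  where open Form₃ (form₃-matrix m)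

ASSA-realisable : ∀ m → Realisable (4 ℕ.+ m) (A ∷ S ∷ S ∷ repeat m [ S ] ++ A ∷ [])
ASSA-realisable m = realised B B-sym (order-1 B-sym B-unit ,
  S-block (2 ℕ.+ m) 2 (λ 2≤j j< → order-S B-sym B-unit zeros
      (nonzero-below B-sym B-unit ≤-refl order-n-A) 2≤j (s≤s⁻¹ j<))
    ((λ {χ} → order-n-A {χ}) , tt))
  -- At least one isolated vertex is present, since the path alone gives `ASA`.
  where open Form₃ (form₃-matrix (suc m))

-- A 4-cycle with m isolated vertices. The cycle has 7 matchings, and deleting any one of its
-- vertices leaves a path with 3.
record Form₄ (m : ℕ) : Set where
  field
    B           : SquareMatrix (4 ℕ.+ m)
    B-sym       : Symmetric B
    B-unit      : UnitDiagonal B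
    zeros       : Zeros B (2 ℕ.+ m)
    order-n-1-A : Order B (3 ℕ.+ m) A
    order-n-A   : Order B (4 ℕ.+ m) A

cycle : SquareMatrix 4
cycle = addVertex (lookup (1ℙ ∷ 0ℙ ∷ 1ℙ ∷ [])) path

form₄-matrix : ∀ m → Form₄ m
form₄-matrix zero = record
  { B = cycle ; B-sym = addVertex-sym path-sym ; B-unit = addVertex-unit path-unit
  ; zeros = λ { (s≤s (s≤s z≤n)) (s≤s (s≤s z≤n)) → 1ℙ ∷ 1ℙ ∷ 0ℙ ∷ 0ℙ ∷ [] , keep (keep (skip (skip []))) , refl }
  ; order-n-1-A = order-n-1 {B = cycle} λ
      { zero → refl ; (suc zero) → refl ; (suc (suc zero)) → refl ; (suc (suc (suc zero))) → refl }
  ; order-n-A = order-n {B = cycle} refl }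
form₄-matrix (suc m) = record
  { B = addIsolated B
  ; B-sym = addVertex-sym B-sym ; B-unit = addVertex-unit B-unit
  ; zeros = addIsolated-zeros {B = B} (s≤s (s≤s z≤n)) zeros
  ; order-n-1-A = addIsolated-order-A {B = B} order-n-A order-n-1-A
  ; order-n-A = addIsolated-order-n {B = B} order-n-A }
  where open Form₄ (form₄-matrix m)

ASSAA-realisable : ∀ m → Realisable (5 ℕ.+ m) (A ∷ S ∷ S ∷ repeat m [ S ] ++ A ∷ A ∷ [])
ASSAA-realisable m = realised B B-sym (order-1 B-sym B-unit ,
  S-block (2 ℕ.+ m) 2 (λ 2≤j j< → order-S B-sym B-unit zeros
      (nonzero-below B-sym B-unit (n≤1+n (4 ℕ.+ m)) order-n-1-A) 2≤j (s≤s⁻¹ j<))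
    ((λ {χ} → order-n-1-A {χ}) , (λ {χ} → order-n-A {χ}) , tt))
  -- At least one isolated vertex is present, since the cycle alone gives `ASAA`.
  where open Form₄ (form₄-matrix (suc m))

-- The zero minors avoid v, so leaves attached to v are isolated on them.
record Form₅ (c : ℕ) : Set where
  field
    B           : SquareMatrix (2 ℕ.+ c)
    B-sym       : Symmetric B
    B-unit      : UnitDiagonal B
    v           : Fin (2 ℕ.+ c)
    zeros       : ∀ {k} → 2 ≤ k → k ≤ c → ∃[ χ ] χ HasSize k × lookup χ v ≡ 0ℙ × pm B χ ≡ 0ℙ
    order-n-1-A : Order B (1 ℕ.+ c) A
    order-n-N   : Order B (2 ℕ.+ c) N

-- The centre is the last index; the first three are the leaves.
star : SquareMatrix 4
star = addVertex (δ (suc (suc zero))) (addVertex (δ (suc zero)) (addVertex (δ zero) singleton))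

form₅-star : Form₅ 2
form₅-star = record
  { B = star
  ; B-sym = addVertex-sym (addVertex-sym (addVertex-sym singleton-sym))
  ; B-unit = addVertex-unit (addVertex-unit (addVertex-unit singleton-unit))
  ; v = zero
  ; zeros = λ { (s≤s (s≤s z≤n)) (s≤s (s≤s z≤n)) →
                0ℙ ∷ 0ℙ ∷ 1ℙ ∷ 1ℙ ∷ [] , skip (skip (keep (keep []))) , refl , refl }
  ; order-n-1-A = order-n-1 {B = star} λ
      { zero → refl ; (suc zero) → refl ; (suc (suc zero)) → refl ; (suc (suc (suc zero))) → refl }
  ; order-n-N = order-n {B = star} refl }

-- A set with both new leaves keeps the old minor, and so does a set with one new leaf that avoids
-- v. Zero sets of size c avoiding v thus extend to sizes c + 1 and c + 2.
form₅-add2Leaves : ∀ {c} → 2 ≤ c → Form₅ c → Form₅ (2 ℕ.+ c)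
form₅-add2Leaves {c} 2≤c form = record
  { B = add2Leaves v B
  ; B-sym = addVertex-sym (addVertex-sym B-sym)
  ; B-unit = addVertex-unit (addVertex-unit B-unit)
  ; v = suc (suc v)
  ; zeros = zeros′
  ; order-n-1-A = order-n-1-A′
  ; order-n-N = order-n {B = add2Leaves v B} (trans (pm-add2Leaves B v full) (order-n-N full-size)) }
  where
  open Form₅ form
  zeros′ : ∀ {k} → 2 ≤ k → k ≤ 2 ℕ.+ c →
           ∃[ χ ] χ HasSize k × lookup χ (suc (suc v)) ≡ 0ℙ × pm (add2Leaves v B) χ ≡ 0ℙ
  zeros′ 2≤k k≤2+c with m≤n⇒m<n∨m≡n k≤2+c
  ... | inj₂ refl =
    let χ , s , v∉ , e = zeros 2≤c ≤-refl
    in 1ℙ ∷ 1ℙ ∷ χ , keep (keep s) , v∉ , trans (pm-add2Leaves B v χ) e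
  ... | inj₁ (s≤s k≤1+c) with m≤n⇒m<n∨m≡n k≤1+c
  ... | inj₂ refl =
    let χ , s , v∉ , e = zeros 2≤c ≤-refl
    in 0ℙ ∷ 1ℙ ∷ χ , skip (keep s) , v∉ ,
       trans (pm-addLeaf B v χ) (cong₂ (λ p x → p + x * pm B (χ ∖ v)) e v∉)
  ... | inj₁ (s≤s k≤c) =
    let χ , s , v∉ , e = zeros 2≤k k≤c
    in 0ℙ ∷ 0ℙ ∷ χ , skip (skip s) , v∉ , e
  -- The minor of all old vertices and one new leaf: the leaf unmatched contributes the full minor
  -- 0, and the leaf matched to v contributes a minor of order c + 1, which is 1.
  pm-full : ∀ {χ} → χ HasSize 2 ℕ.+ c → pm B χ + lookup χ v * pm B (χ ∖ v) ≡ 1ℙ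
  pm-full {χ} s = cong₂ _+_ (order-n-N s)
    (cong₂ _*_ v∈ (order-n-1-A (∖-size s v∈)))
    where
    v∈ : v ∈ χ
    v∈ = trans (cong (λ ψ → lookup ψ v) (size-full s)) (lookup-replicate v 1ℙ)
  order-n-1-A′ : Order (add2Leaves v B) (3 ℕ.+ c) A
  order-n-1-A′ (skip (skip s))         = contradiction (size-≤ s) 1+n≰n
  order-n-1-A′ (skip (keep {χ = χ} s)) = trans (pm-addLeaf B v χ) (pm-full s)
  order-n-1-A′ (keep (skip {χ = χ} s)) = trans (pm-addLeaf (addVertex (δ v) B) (suc v) (0ℙ ∷ χ)) (pm-full s)
  order-n-1-A′ (keep (keep {χ = χ} s)) = trans (pm-add2Leaves B v χ) (order-n-1-A s)

form₅-matrix : ∀ q → Form₅ (2 ℕ.+ q ℕ.* 2)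
form₅-matrix zero    = form₅-star
form₅-matrix (suc q) = form₅-add2Leaves (s≤s (s≤s z≤n)) (form₅-matrix q)

ASSSAN-realisable : ∀ q → Realisable (6 ℕ.+ q ℕ.* 2)
                      (A ∷ S ∷ S ∷ S ∷ repeat (q ℕ.* 2) [ S ] ++ A ∷ N ∷ [])
ASSSAN-realisable q = realised B B-sym (order-1 B-sym B-unit ,
  S-block (3 ℕ.+ q ℕ.* 2) 2 (λ 2≤j j< → order-S B-sym B-unit
      (λ 2≤k k≤c → let χ , s , _ , e = zeros 2≤k k≤c in χ , s , e)
      (nonzero-below B-sym B-unit (n≤1+n (5 ℕ.+ q ℕ.* 2)) order-n-1-A) 2≤j (s≤s⁻¹ j<))
    ((λ {χ} → order-n-1-A {χ}) , (λ {χ} → order-n-N {χ}) , tt))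
  -- At least one pair of leaves is attached, since the star alone gives `ASAN`.
  where open Form₅ (form₅-matrix (suc q))

-- Lengths of the forms and sufficiency

length-repeat : ∀ m (w : List Letter) ls → length (repeat m w ++ ls) ≡ m ℕ.* length w ℕ.+ length ls
length-repeat zero    w ls = refl
length-repeat (suc m) w ls = begin
  length ((w ++ repeat m w) ++ ls)
    ≡⟨ cong length (++-assoc w (repeat m w) ls) ⟩
  length (w ++ (repeat m w ++ ls))
    ≡⟨ length-++ w ⟩
  length w ℕ.+ length (repeat m w ++ ls)
    ≡⟨ cong (length w ℕ.+_) (length-repeat m w ls) ⟩
  length w ℕ.+ (m ℕ.* length w ℕ.+ length ls)
    ≡⟨ ℕ.+-assoc (length w) _ _ ⟨
  suc m ℕ.* length w ℕ.+ length ls ∎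

length-block : ∀ m l ls → length (repeat m [ l ] ++ ls) ≡ m ℕ.+ length ls
length-block m l ls = trans (length-repeat m [ l ] ls) (cong (ℕ._+ length ls) (ℕ.*-identityʳ m))

length-constant : ∀ m l → length (repeat m [ l ]) ≡ m
length-constant m l = trans (cong length (sym (++-identityʳ (repeat m [ l ]))))
  (trans (length-block m l []) (ℕ.+-identityʳ m))

2∣6+⇒*2 : ∀ {m} → 2 ∣ 6 ℕ.+ m → ∃[ q ] m ≡ q ℕ.* 2
2∣6+⇒*2 (divides (suc (suc (suc q))) eq) = q , ℕ.+-cancelˡ-≡ 6 _ _ eq

resize : ∀ {n n′ ls} → n ≡ n′ → Realisable n ls → Realisable n′ ls
resize refl r = r

-- The constructions have their order in closed form, and `resize` transports them to the length of
-- the list. For the form ending in AN, evenness of the order turns the number of repeated S into a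
-- double.
sufficiency : ∀ ls → HasForm (length ls) ls → Realisable (length ls) ls
sufficiency _ (form₁ (m , refl)) =
  resize (cong suc (sym (length-constant m A))) (all-A-realisable m)
sufficiency _ (form₂ (m , p , refl)) = resize
  (cong suc (sym (trans (length-block m S (N ∷ repeat p [ N ]))
    (trans (ℕ.+-suc m _) (cong (λ l → suc (m ℕ.+ l)) (length-constant p N))))))
  (ASN-realisable m p)
sufficiency _ (form₃ (m , refl)) = resize
  (cong (3 ℕ.+_) (sym (trans (length-block m S (A ∷ [])) (ℕ.+-comm m 1))))
  (ASSA-realisable m)
sufficiency _ (form₄ (m , refl)) = resize
  (cong (3 ℕ.+_) (sym (trans (length-block m S (A ∷ A ∷ [])) (ℕ.+-comm m 2))))
  (ASSAA-realisable m)
sufficiency _ (form₅ ((m , refl) , 2∣n)) = finish (2∣6+⇒*2 (subst (2 ∣_) length≡ 2∣n))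
  where
  length≡ : length (A ∷ S ∷ S ∷ S ∷ repeat m [ S ] ++ A ∷ N ∷ []) ≡ 6 ℕ.+ m
  length≡ = cong (4 ℕ.+_) (trans (length-block m S (A ∷ N ∷ [])) (ℕ.+-comm m 2))
  finish : ∃[ q ] m ≡ q ℕ.* 2 → Realisable _ (A ∷ S ∷ S ∷ S ∷ repeat m [ S ] ++ A ∷ N ∷ [])
  finish (q , refl) = resize (sym length≡) (ASSSAN-realisable q)
sufficiency _ (form₆ (m , refl)) = resize
  (cong (3 ℕ.+_) (sym (trans (cong length (sym (++-identityʳ (repeat m (S ∷ A ∷ [])))))
    (trans (length-repeat m (S ∷ A ∷ []) []) (ℕ.+-identityʳ (m ℕ.* 2))))))
  (subst (λ ls → Realisable (3 ℕ.+ m ℕ.* 2) (A ∷ S ∷ A ∷ ls)) (++-identityʳ (repeat m (S ∷ A ∷ [])))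
    (ASA-realisable m))
sufficiency _ (form₇ (m , refl)) = resize
  (cong (3 ℕ.+_) (sym (trans (length-repeat m (S ∷ A ∷ []) (A ∷ [])) (ℕ.+-comm (m ℕ.* 2) 1))))
  (ASAA-realisable m)
sufficiency _ (form₈ (m , refl)) = resize
  (cong (3 ℕ.+_) (sym (trans (length-repeat m (S ∷ A ∷ []) (N ∷ [])) (ℕ.+-comm (m ℕ.* 2) 1))))
  (ASAN-realisable m)

-- Between positions in a vector and orders of minors

module _ {n} {B : SquareMatrix n} where

  toLetters : ∀ {m} k (t : Vec Letter m) → (∀ i → Order B (toℕ i ℕ.+ k) (lookup t i)) →
              Letters B k (toList t)
  toLetters k []      h = tt
  toLetters k (l ∷ t) h = h zero , toLetters (suc k) t
    (λ i → subst (λ j → Order B j (lookup t i)) (sym (ℕ.+-suc (toℕ i) k)) (h (suc i)))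

  fromLetters : ∀ {m} k (t : Vec Letter m) → Letters B k (toList t) →
                ∀ i → Order B (toℕ i ℕ.+ k) (lookup t i)
  fromLetters k (l ∷ t) (h , hs) zero    = h
  fromLetters k (l ∷ t) (h , hs) (suc i) =
    subst (λ j → Order B j (lookup t i)) (ℕ.+-suc (toℕ i) k) (fromLetters (suc k) t hs i)

module _ {n} {B : SquareMatrix n} (B-sym : Symmetric B) (t : Vec Letter n) where

  isEpr⇒letters : IsEpr B t → Letters B 1 (toList t)
  isEpr⇒letters epr = toLetters 1 t λ i →
    subst (λ j → Order B j (lookup t i)) (ℕ.+-comm 1 (toℕ i)) (HasLetter⇒Order B-sym (lookup t i) (epr i))

  letters⇒isEpr : Letters B 1 (toList t) → IsEpr B t
  letters⇒isEpr hs i = Order⇒HasLetter B-sym (lookup t i)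
    (subst (λ j → Order B j (lookup t i)) (ℕ.+-comm (toℕ i) 1) (fromLetters 1 t hs i))

theorem3p8 : ∀ (n-1 : ℕ) → let n = suc n-1 in
    (t : Vec Letter n) → head t ≡ A →
    AttainableOver ℤ₂ t ⇔
    ( (∃[ m ] toList t ≡ A ∷ repeat m [ A ])
    ⊎ (∃[ m ] ∃[ p ] toList t ≡ A ∷ repeat m [ S ] ++ N ∷ repeat p [ N ])
    ⊎ (∃[ m ] toList t ≡ A ∷ S ∷ S ∷ repeat m [ S ] ++ A ∷ [])
    ⊎ (∃[ m ] toList t ≡ A ∷ S ∷ S ∷ repeat m [ S ] ++ A ∷ A ∷ [])
    ⊎ ((∃[ m ] toList t ≡ A ∷ S ∷ S ∷ S ∷ repeat m [ S ] ++ A ∷ N ∷ []) × 2 ∣ n)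
    ⊎ (∃[ m ] toList t ≡ A ∷ S ∷ A ∷ repeat m (S ∷ A ∷ []))
    ⊎ (∃[ m ] toList t ≡ A ∷ S ∷ A ∷ repeat m (S ∷ A ∷ []) ++ A ∷ [])
    ⊎ (∃[ m ] toList t ≡ A ∷ S ∷ A ∷ repeat m (S ∷ A ∷ []) ++ N ∷ []))
theorem3p8 n-1 t@(A ∷ ls) refl = mk⇔ only-if if
  where
  length≡ : length (toList t) ≡ suc n-1
  length≡ = length-toList t
  only-if : AttainableOver ℤ₂ t → HasForm (suc n-1) (toList t)
  only-if (B , B-sym , epr) =
    let _ , hs = isEpr⇒letters B-sym t epr
    -- The leading A says that the diagonal consists of ones.
    in necessity B-sym (unitDiagonal {B = B} (epr zero)) (toList ls) (length-toList ls) hs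
  if : HasForm (suc n-1) (toList t) → AttainableOver ℤ₂ t
  if form =
    let realised B B-sym hs = resize length≡ (sufficiency (toList t)
                           (subst (λ n → HasForm n (toList t)) (sym length≡) form))
    in B , B-sym , letters⇒isEpr B-sym t hs
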